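{- For every integer $n \geq 1$, there exists a cyclically $5$-edge-connected snark $H_n$ with exactly $40n+2$ vertices such that $r(H_n) = 2$ and $r_f(H_n) = n$.
   Context: A snark is a $2$-connected cubic graph that admits no proper $3$-edge-coloring. For a set $X \subseteq V(G)$, $\partial_G(X)$ denotes the set of edges with exactly one end in $X$; such an edge-cut is cyclic if both the subgraph induced by $X$ and the subgraph induced by $V(G)\setminus X$ contain a cycle. A graph is cyclically $k$-edge-connected if it has no cyclic edge-cut with fewer than $k$ edges. The resistance $r(G)$ of a cubic graph $G$ is the minimum number of edges whose removal leaves a $3$-edge-colorable graph. A $\mathbb{Z}_2\times\mathbb{Z}_2$-flow on $G$ is a map $f\colon E(G)\to \mathbb{Z}_2\times\mathbb{Z}_2$ such that at every vertex the sum of the values on the incident edges is $0$ (orientations are irrelevant in this group); it is nowhere-zero if $f(e)\neq 0$ for all $e$. The flow resistance $r_f(G)$ is the minimum number of edges whose removal leaves a graph admitting a nowhere-zero $\mathbb{Z}_2\times\mathbb{Z}_2$-flow. -}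

module Defs where

open import Data.Nat using (ℕ; zero; suc; _+_; _≤_)
open import Data.Fin using (Fin; zero; suc; _≟_)
open import Data.Bool using (Bool; true; false; T; not; _∨_; _∧_; _xor_; if_then_else_)
open import Data.Product using (Σ; _×_; _,_)
open import Data.Sum using (_⊎_)
open import Data.List using (List; []; _∷_; _++_; length)
open import Data.List.Relation.Unary.All using (All)
open import Data.List.Relation.Unary.Unique.Propositional using (Unique)
open import Data.Unit using (⊤)
open import Relation.Nullary using (¬_)
open import Relation.Nullary.Decidable using (⌊_⌋)
open import Relation.Binary.PropositionalEquality using (_≡_; _≢_)

count : {k : ℕ} → (Fin k → Bool) → ℕ
count {zero}  p = 0
count {suc k} p = (if p zero then 1 else 0) + count (λ i → p (suc i))

Z2² : Set
Z2² = Bool × Bool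

zero² : Z2²
zero² = false , false

_⊕_ : Z2² → Z2² → Z2²
(a , b) ⊕ (c , d) = (a xor c) , (b xor d)

sum² : {k : ℕ} → (Fin k → Z2²) → Z2²
sum² {zero}  f = zero²
sum² {suc k} f = f zero ⊕ sum² (λ i → f (suc i))

record Graph : Set where
  field
    nV : ℕ
    nE : ℕ
    src : Fin nE → Fin nV
    tgt : Fin nE → Fin nV
    loopless : ∀ e → src e ≢ tgt e
    noParallel : ∀ e e' →
      ((src e ≡ src e' × tgt e ≡ tgt e') ⊎ (src e ≡ tgt e' × tgt e ≡ src e')) → e ≡ e'

module _ (G : Graph) where
  open Graph G

  incident : Fin nE → Fin nV → Bool
  incident e v = ⌊ src e ≟ v ⌋ ∨ ⌊ tgt e ≟ v ⌋

  degree : Fin nV → ℕ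
  degree v = count (λ e → incident e v)

  Cubic : Set
  Cubic = ∀ v → degree v ≡ 3

  Adj : Fin nV → Fin nV → Set
  Adj u w = Σ (Fin nE) λ e → (src e ≡ u × tgt e ≡ w) ⊎ (src e ≡ w × tgt e ≡ u)

  data Reach (W : Fin nV → Bool) : Fin nV → Fin nV → Set where
    here : ∀ {u} → T (W u) → Reach W u u
    step : ∀ {u w v} → T (W u) → Adj u w → Reach W w v → Reach W u v

  ConnectedOn : (Fin nV → Bool) → Set
  ConnectedOn W = ∀ u v → T (W u) → T (W v) → Reach W u v

  TwoConnected : Set
  TwoConnected = (3 ≤ nV) × ConnectedOn (λ _ → true)
               × (∀ x → ConnectedOn (λ v → not ⌊ v ≟ x ⌋))

  -- Edge sets S : Fin nE → Bool (S e = true means e is removed); |S| = count S.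

  ColorableMinus : (Fin nE → Bool) → Set
  ColorableMinus S = Σ (Fin nE → Fin 3) λ c →
    ∀ e e' → e ≢ e' → S e ≡ false → S e' ≡ false →
    (Σ (Fin nV) λ v → T (incident e v) × T (incident e' v)) → c e ≢ c e'

  ThreeEdgeColorable : Set
  ThreeEdgeColorable = ColorableMinus (λ _ → false)

  NZFlowMinus : (Fin nE → Bool) → Set
  NZFlowMinus S = Σ (Fin nE → Z2²) λ f →
    (∀ e → S e ≡ false → f e ≢ zero²) ×
    (∀ v → sum² (λ e → if incident e v ∧ not (S e) then f e else zero²) ≡ zero²)

  ResistanceIs : ℕ → Set
  ResistanceIs k = (Σ (Fin nE → Bool) λ S → count S ≡ k × ColorableMinus S)
                 × (∀ S → ColorableMinus S → k ≤ count S)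

  FlowResistanceIs : ℕ → Set
  FlowResistanceIs k = (Σ (Fin nE → Bool) λ S → count S ≡ k × NZFlowMinus S)
                     × (∀ S → NZFlowMinus S → k ≤ count S)

  Snark : Set
  Snark = TwoConnected × Cubic × ¬ ThreeEdgeColorable

  AdjChain : List (Fin nV) → Set
  AdjChain [] = ⊤
  AdjChain (x ∷ []) = ⊤
  AdjChain (x ∷ y ∷ r) = Adj x y × AdjChain (y ∷ r)

  HasCycleIn : (Fin nV → Bool) → Set
  HasCycleIn X = Σ (Fin nV) λ v → Σ (List (Fin nV)) λ rest →
    (2 ≤ length rest) × Unique (v ∷ rest) × All (λ x → T (X x)) (v ∷ rest)
    × AdjChain (v ∷ rest ++ v ∷ [])

  cutSize : (Fin nV → Bool) → ℕ
  cutSize X = count (λ e → X (src e) xor X (tgt e))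

  CyclicallyEdgeConnected : ℕ → Set
  CyclicallyEdgeConnected k = ∀ X → HasCycleIn X → HasCycleIn (λ v → not (X v)) → k ≤ cutSize X

{-# OPTIONS --safe #-}
-- H is a ring of 2n poles, each joined to the next by a connector of three edges.  In a flow
-- the sum s of the three values on a connector is the same all around the ring.  Poles of kind
-- A (cut out of the Petersen graph by deleting two non-adjacent vertices) admit no nowhere-zero
-- flow with s = 0, poles of kind B admit none with s ≠ 0.  With n poles of each kind every flow
-- therefore has at least n zeros, and n suffice (s = 0 and one zero in each A).  As all A's are
-- consecutive, a 3-edge-colouring with s ≠ 0 along the A's and s = 0 along the B's has to
-- change s only twice, and each change costs a single edge.
--
-- For the cyclic connectivity, a vertex with two cut edges may change sides, so one may assume
-- that every vertex meets at most one cut edge; then the labelling of each pole is constant or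
-- expensive, and the ring structure does the rest.
module Submission where

open import Defs
open import Algebra.Bundles using (CommutativeMonoid)
open import Algebra.Structures using (IsCommutativeMonoid)
open import Data.Bool using (Bool; T; T?; _xor_; _∧_; _∨_; false; if_then_else_; not; true)
open import Data.Bool.Properties using (not-involutive; xor-assoc; xor-comm; xor-identityʳ; xor-same) renaming (_≟_ to _≟ᵇ_)
open import Data.Empty using (⊥; ⊥-elim)
open import Data.Fin using (#_; Fin; _↑ʳ_; _↑ˡ_; _≟_; fromℕ; inject₁; splitAt; suc; toℕ; zero)
open import Data.Fin.Induction using (<-weakInduction; <-weakInduction-startingFrom)
open import Data.Fin.Properties using (all?; any?; splitAt-↑ʳ; splitAt-↑ˡ; splitAt⁻¹-↑ʳ; splitAt⁻¹-↑ˡ; toℕ-inject₁; ↑ˡ-injective; ≤fromℕ)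
open import Data.Fin.Relation.Unary.Top using (View; view; view-fromℕ; view-inject₁; ‵fromℕ; ‵inject₁)
open import Data.List using (List; []; _++_; _∷_; allFin; concatMap; filter; foldr; map)
open import Data.List.Membership.Propositional using (_∈_)
open import Data.List.Relation.Unary.All as All using (All; []; _∷_)
open import Data.List.Relation.Unary.AllPairs using ([]; _∷_)
open import Data.List.Relation.Unary.Any using (here; there)
open import Data.List.Relation.Unary.Unique.DecPropositional using (unique?)
open import Data.List.Relation.Unary.Unique.Propositional using (Unique)
open import Data.Maybe using (Maybe; just; nothing)
open import Data.Maybe.Properties using (just-injective) renaming (≡-dec to Maybe-≡-dec)
open import Data.Nat using (_*_; _+_; _<_; _≤?_; _≤_; _≤ᵇ_; suc; s≤s; zero; z≤n; ℕ)
open import Data.Nat.Properties using (+-0-isCommutativeMonoid; +-assoc; +-comm; +-identityʳ; +-mono-≤; +-monoʳ-≤; +-monoˡ-<; +-monoˡ-≤; 1+n≢n; <-≤-trans; m+1+n≢0; module ≤-Reasoning; m≤m+n; m≤n+m; ≤-pred; ≤-refl; ≤-reflexive; ≤-trans; ≤ᵇ⇒≤; ≤⇒≯; ≰⇒>)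
open import Data.Nat.Solver using (module +-*-Solver)
open import Data.Product using (_,_; _×_; proj₁; proj₂; Σ)
open import Data.Product.Properties using (≡-dec)
open import Data.Sum using ([_,_]′; _⊎_; inj₁; inj₂)
open import Data.Unit using (tt; ⊤)
open import Data.Vec using (Vec; []; _[_]≔_; _∷_; lookup; replicate) renaming (_++_ to _++ᵛ_)
open import Data.Vec.Properties using (lookup-replicate; lookup∘update; lookup∘update′)
open import Function using (_∘_)
open import Relation.Binary.PropositionalEquality using (_≡_; _≢_; cong; cong₂; isEquivalence; module ≡-Reasoning; refl; subst; sym; trans)
open import Relation.Nullary using (Dec; no; yes; ¬_)
open import Relation.Nullary.Decidable using (True; _×-dec_; _→-dec_; _⊎-dec_; decidable-stable; toWitness; ¬?; ⌊_⌋)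
import Algebra.Properties.CommutativeMonoid.Sum as CMSum

-- Sums over finite and block-decomposed index sets

-- What drives the A poles is that the Petersen graph has no 3-edge-colouring. Deleting two
-- non-adjacent vertices leaves a triple of dangling edges at each; by conservation a flow with sum
-- zero on one triple has sum zero on the other, so a nowhere-zero one would extend to the Petersen
-- graph when the two vertices are restored. Two obstacles shape the poles. A zero on a connector
-- could serve both of its poles; so each connector is owned by the pole it enters, out-edges may
-- vanish, and a further part behind the last Petersen part keeps the forced zeros among the owned
-- edges. Also, a labelled path may cross a pole at the price of two inner edges, so a cycle winding
-- around a ring of two poles might be cut off by four edges. One A has 14 instead of 12 vertices
-- and makes every such crossing cost three; this strict pole also accounts for the 2 in `40n+2`,
-- since `12 + 28 = 40`. The facts about single poles are finite and independent of `n`, so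
-- evaluation settles them; `n` enters only through the ring.

total : ∀ {m} → (Fin m → ℕ) → ℕ
total {zero}  sz = 0
total {suc m} sz = sz zero + total (sz ∘ suc)

enc : ∀ {m} (sz : Fin m → ℕ) (i : Fin m) → Fin (sz i) → Fin (total sz)
enc sz zero    j = j ↑ˡ _
enc sz (suc i) j = sz zero ↑ʳ enc (sz ∘ suc) i j

-- A view for proofs: matching on it replaces an index by its block and position. Definitions use
-- `dec` instead, which comes with the rewriting rule `dec-enc`.
data Encoded {m} (sz : Fin m → ℕ) : Fin (total sz) → Set where
  at : ∀ i j → Encoded sz (enc sz i j)

decode : ∀ {m} (sz : Fin m → ℕ) (k : Fin (total sz)) → Encoded sz k
decode {suc m} sz k with splitAt (sz zero) k in eq
... | inj₁ j = subst (Encoded sz) (splitAt⁻¹-↑ˡ eq) (at zero j)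
... | inj₂ r = subst (Encoded sz) (splitAt⁻¹-↑ʳ eq) (shift (decode (sz ∘ suc) r))
  where
  shift : ∀ {r} → Encoded (sz ∘ suc) r → Encoded sz (sz zero ↑ʳ r)
  shift (at i j) = at (suc i) j

dec : ∀ {m} (sz : Fin m → ℕ) → Fin (total sz) → Σ (Fin m) (Fin ∘ sz)
dec {suc m} sz k with splitAt (sz zero) k
... | inj₁ j = zero , j
... | inj₂ r = suc (proj₁ (dec (sz ∘ suc) r)) , proj₂ (dec (sz ∘ suc) r)

dec-enc : ∀ {m} (sz : Fin m → ℕ) i j → dec sz (enc sz i j) ≡ (i , j)
dec-enc sz zero    j rewrite splitAt-↑ˡ (sz zero) j (total (sz ∘ suc)) = refl
dec-enc sz (suc i) j
  rewrite splitAt-↑ʳ (sz zero) (total (sz ∘ suc)) (enc (sz ∘ suc) i j) | dec-enc (sz ∘ suc) i j = refl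

if-yes : ∀ {A : Set} {P : Set} (d : Dec P) {x y : A} → P → (if ⌊ d ⌋ then x else y) ≡ x
if-yes (yes _) _ = refl
if-yes (no ¬p) p = ⊥-elim (¬p p)

if-no : ∀ {A : Set} {P : Set} (d : Dec P) {x y : A} → ¬ P → (if ⌊ d ⌋ then x else y) ≡ y
if-no (yes p) ¬p = ⊥-elim (¬p p)
if-no (no _)  _  = refl

module Summation {A : Set} {_∙_ : A → A → A} {ε : A} (isCM : IsCommutativeMonoid _≡_ _∙_ ε) where

  monoid : CommutativeMonoid _ _
  monoid = record { isCommutativeMonoid = isCM }

  open CMSum monoid public using (sum; sum-cong-≗; ∑-distrib-+; ∑-comm; sum-replicate-zero)
  open IsCommutativeMonoid isCM using (identityˡ; identityʳ; assoc; comm)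

  sum-ε : ∀ {n} {f : Fin n → A} → (∀ i → f i ≡ ε) → sum f ≡ ε
  sum-ε {n} f≡ε = trans (sum-cong-≗ f≡ε) (sum-replicate-zero n)

  sum-δ : ∀ {n} (i : Fin n) (g : Fin n → A) → sum (λ k → if ⌊ k ≟ i ⌋ then g k else ε) ≡ g i
  sum-δ {suc n} zero g = trans (cong (g zero ∙_) (sum-ε {n} {λ k → ε} (λ _ → refl))) (identityʳ _)
  sum-δ {suc n} (suc i) g = trans (identityˡ _) (trans (sum-cong-≗ same) (sum-δ i (g ∘ suc)))
    where
    same : ∀ k → (if ⌊ suc k ≟ suc i ⌋ then g (suc k) else ε) ≡ (if ⌊ k ≟ i ⌋ then g (suc k) else ε)
    same k with k ≟ i
    ... | yes _ = refl
    ... | no  _ = refl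

  sum-split : ∀ m {n} (f : Fin (m + n) → A) → sum f ≡ sum (λ i → f (i ↑ˡ n)) ∙ sum (λ j → f (m ↑ʳ j))
  sum-split zero    f = sym (identityˡ _)
  sum-split (suc m) f = trans (cong (f zero ∙_) (sum-split m (f ∘ suc))) (sym (assoc _ _ _))

  sum-blocks : ∀ {m} (sz : Fin m → ℕ) (f : Fin (total sz) → A) →
    sum f ≡ sum (λ i → sum (λ j → f (enc sz i j)))
  sum-blocks {zero}  sz f = refl
  sum-blocks {suc m} sz f =
    trans (sum-split (sz zero) f) (cong (sum (λ j → f (enc sz zero j)) ∙_) (sum-blocks (sz ∘ suc) (λ r → f (sz zero ↑ʳ r))))

  -- For sums over the edges at a vertex, which test all edges for incidence: they become sums over
  -- three slots. The test `p k` is replaced by a sum over `j` of the tests `k ≟ e j`, of which at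
  -- most one succeeds by injectivity, and the two sums are exchanged.
  sum-image : ∀ {m n} (p : Fin n → Bool) (e : Fin m → Fin n) →
    (∀ {i j} → e i ≡ e j → i ≡ j) → (∀ j → p (e j) ≡ true) → (∀ k → p k ≡ true → Σ (Fin m) λ j → e j ≡ k) →
    (g : Fin n → A) → sum (λ k → if p k then g k else ε) ≡ sum (g ∘ e)
  sum-image {m} {n} p e inj sound complete g = begin
    sum (λ k → if p k then g k else ε)                            ≡⟨ sum-cong-≗ pointwise ⟩
    sum (λ k → sum (λ j → if ⌊ k ≟ e j ⌋ then g k else ε))        ≡⟨ ∑-comm (λ k j → if ⌊ k ≟ e j ⌋ then g k else ε) ⟩
    sum (λ j → sum (λ k → if ⌊ k ≟ e j ⌋ then g k else ε))        ≡⟨ sum-cong-≗ (λ j → sum-δ (e j) g) ⟩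
    sum (g ∘ e)                                                   ∎
    where
    open ≡-Reasoning
    pointwise : ∀ k → (if p k then g k else ε) ≡ sum (λ j → if ⌊ k ≟ e j ⌋ then g k else ε)
    pointwise k with p k in eq
    ... | false = sym (sum-ε λ j → if-no (k ≟ e j) λ k≡ → absurd (trans (sym eq) (trans (cong p k≡) (sound j))))
      where
      absurd : ¬ (false ≡ true)
      absurd ()
    ... | true with complete k eq
    ...   | j₀ , refl = sym (trans (sum-cong-≗ same) (sum-δ j₀ (λ _ → g (e j₀))))
      where
      same : ∀ j → (if ⌊ e j₀ ≟ e j ⌋ then g (e j₀) else ε) ≡ (if ⌊ j ≟ j₀ ⌋ then g (e j₀) else ε)
      same j with j ≟ j₀
      ... | yes refl = if-yes (e j ≟ e j) refl
      ... | no  j≢j₀ = if-no (e j₀ ≟ e j) (λ q → j≢j₀ (sym (inj q)))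

  sum-partition : ∀ {n} (p : Fin n → Bool) (g : Fin n → A) →
    sum g ≡ sum (λ k → if p k then g k else ε) ∙ sum (λ k → if p k then ε else g k)
  sum-partition p g = trans (sum-cong-≗ pointwise) (∑-distrib-+ (λ k → if p k then g k else ε) (λ k → if p k then ε else g k))
    where
    pointwise : ∀ k → g k ≡ ((if p k then g k else ε) ∙ (if p k then ε else g k))
    pointwise k with p k
    ... | true  = sym (identityʳ _)
    ... | false = sym (identityˡ _)

module ℕΣ = Summation +-0-isCommutativeMonoid

⊕-assoc : ∀ x y z → ((x ⊕ y) ⊕ z) ≡ (x ⊕ (y ⊕ z))
⊕-assoc (a , b) (c , d) (e , f) = cong₂ _,_ (xor-assoc a c e) (xor-assoc b d f)

⊕-comm : ∀ x y → (x ⊕ y) ≡ (y ⊕ x)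
⊕-comm (a , b) (c , d) = cong₂ _,_ (xor-comm a c) (xor-comm b d)

⊕-identityʳ : ∀ x → (x ⊕ zero²) ≡ x
⊕-identityʳ (a , b) = cong₂ _,_ (xor-identityʳ a) (xor-identityʳ b)

⊕-self : ∀ x → (x ⊕ x) ≡ zero²
⊕-self (a , b) = cong₂ _,_ (xor-same a) (xor-same b)

⊕-isCommutativeMonoid : IsCommutativeMonoid _≡_ _⊕_ zero²
⊕-isCommutativeMonoid = record
  { isMonoid = record
    { isSemigroup = record
      { isMagma = record { isEquivalence = isEquivalence ; ∙-cong = cong₂ _⊕_ }
      ; assoc = ⊕-assoc }
    ; identity = (λ _ → refl) , ⊕-identityʳ }
  ; comm = ⊕-comm }

module ZΣ = Summation ⊕-isCommutativeMonoid

⊕-cancel : ∀ x y → (x ⊕ y) ≡ zero² → x ≡ y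
⊕-cancel x y xy≡0 = begin
  x             ≡⟨ ⊕-identityʳ x ⟨
  x ⊕ zero²     ≡⟨ cong (x ⊕_) (⊕-self y) ⟨
  x ⊕ (y ⊕ y)   ≡⟨ ⊕-assoc x y y ⟨
  (x ⊕ y) ⊕ y   ≡⟨ cong (_⊕ y) xy≡0 ⟩
  y             ∎
  where open ≡-Reasoning

bit : Bool → ℕ
bit b = if b then 1 else 0

count≡sum : ∀ {n} (p : Fin n → Bool) → count p ≡ ℕΣ.sum (bit ∘ p)
count≡sum {zero}  p = refl
count≡sum {suc n} p = cong (bit (p zero) +_) (count≡sum (p ∘ suc))

sum²≡sum : ∀ {n} (f : Fin n → Z2²) → sum² f ≡ ZΣ.sum f
sum²≡sum {zero}  f = refl
sum²≡sum {suc n} f = cong (f zero ⊕_) (sum²≡sum (f ∘ suc))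

sum-mono-≤ : ∀ {n} {f g : Fin n → ℕ} → (∀ i → f i ≤ g i) → ℕΣ.sum f ≤ ℕΣ.sum g
sum-mono-≤ {zero}  f≤g = z≤n
sum-mono-≤ {suc n} f≤g = +-mono-≤ (f≤g zero) (sum-mono-≤ (f≤g ∘ suc))

term≤sum : ∀ {n} (g : Fin n → ℕ) i → g i ≤ ℕΣ.sum g
term≤sum g zero    = m≤m+n _ _
term≤sum g (suc i) = ≤-trans (term≤sum (g ∘ suc) i) (m≤n+m _ _)

terms≤sum : ∀ {n} (g : Fin n → ℕ) {i j} → i ≢ j → g i + g j ≤ ℕΣ.sum g
terms≤sum g {zero}  {zero}  i≢j = ⊥-elim (i≢j refl)
terms≤sum g {zero}  {suc j} i≢j = +-monoʳ-≤ (g zero) (term≤sum (g ∘ suc) j)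
terms≤sum g {suc i} {zero}  i≢j =
  subst (_≤ ℕΣ.sum g) (+-comm (g zero) (g (suc i))) (+-monoʳ-≤ (g zero) (term≤sum (g ∘ suc) i))
terms≤sum g {suc i} {suc j} i≢j = ≤-trans (terms≤sum (g ∘ suc) (i≢j ∘ cong suc)) (m≤n+m _ _)

true≢false : true ≢ false
true≢false ()

T→≡true : ∀ {b} → T b → b ≡ true
T→≡true {true} _ = refl

xor-equal : ∀ {a b} → a ≡ b → a xor b ≡ false
xor-equal {a} refl = xor-same a

bits≤1 : (t : Fin 3 → Bool) → ∀ {j j'} → j ≢ j' → t j ≡ false → t j' ≡ false →
  ℕΣ.sum (bit ∘ t) ≤ 1
bits≤1 t {zero} {zero} j≢j' p q = ⊥-elim (j≢j' refl)
bits≤1 t {zero} {suc zero} _ p q rewrite p | q with t (suc (suc zero))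
... | true = s≤s z≤n
... | false = z≤n
bits≤1 t {zero} {suc (suc zero)} _ p q rewrite p | q with t (suc zero)
... | true = s≤s z≤n
... | false = z≤n
bits≤1 t {suc zero} {suc (suc zero)} _ p q rewrite p | q with t zero
... | true = s≤s z≤n
... | false = z≤n
bits≤1 t {suc zero} {suc zero} j≢j' p q = ⊥-elim (j≢j' refl)
bits≤1 t {suc (suc zero)} {suc (suc zero)} j≢j' p q = ⊥-elim (j≢j' refl)
bits≤1 t {suc zero} {zero} j≢j' p q = bits≤1 t (j≢j' ∘ sym) q p
bits≤1 t {suc (suc zero)} {zero} j≢j' p q = bits≤1 t (j≢j' ∘ sym) q p
bits≤1 t {suc (suc zero)} {suc zero} j≢j' p q = bits≤1 t (j≢j' ∘ sym) q p

flip-bits : (t : Fin 3 → Bool) → 2 ≤ ℕΣ.sum (bit ∘ t) → ℕΣ.sum (bit ∘ not ∘ t) ≤ 1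
flip-bits t 2≤ with t zero | t (suc zero) | t (suc (suc zero))
... | true  | true  | true  = z≤n
... | true  | true  | false = s≤s z≤n
... | true  | false | true  = s≤s z≤n
... | false | true  | true  = s≤s z≤n
flip-bits t (s≤s ()) | true  | false | false
flip-bits t (s≤s ()) | false | true  | false
flip-bits t (s≤s ()) | false | false | true
flip-bits t () | false | false | false

-- Cubic graphs given by the three edges at each vertex

module _ (G : Graph) where
  open Graph G

  End : Fin nE → Fin nV → Set
  End e v = src e ≡ v ⊎ tgt e ≡ v

  -- Where `incident` is a test on all edges, this lists the three edges at a vertex, so that vertex
  -- sums unfold to three terms.
  record Incidences : Set where
    field
      inc          : Fin nV → Fin 3 → Fin nE
      inc-distinct : ∀ v {j j'} → inc v j ≡ inc v j' → j ≡ j'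
      inc-sound    : ∀ v j → End (inc v j) v
      inc-complete : ∀ e v → End e v → Σ (Fin 3) λ j → inc v j ≡ e

module CubicGraph (G : Graph) (I : Incidences G) where
  open Graph G
  open Incidences I

  incident-yes : ∀ {e v} → End G e v → incident G e v ≡ true
  incident-yes {e} {v} end with src e ≟ v | tgt e ≟ v
  ... | yes _ | _     = refl
  ... | no _  | yes _ = refl
  ... | no s≢ | no t≢ = ⊥-elim ([ s≢ , t≢ ]′ end)

  incident-end : ∀ {e v} → incident G e v ≡ true → End G e v
  incident-end {e} {v} eq with src e ≟ v | tgt e ≟ v
  ... | yes p | _     = inj₁ p
  ... | no _  | yes q = inj₂ q
  incident-end {e} {v} () | no _ | no _

  T-incident : ∀ {e v} → T (incident G e v) → End G e v
  T-incident {e} {v} t with incident G e v in eq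
  ... | true = incident-end eq

  private
    inc-incident : ∀ v j → incident G (inc v j) v ≡ true
    inc-incident v j = incident-yes (inc-sound v j)

    inc-cover : ∀ v e → incident G e v ≡ true → Σ (Fin 3) λ j → inc v j ≡ e
    inc-cover v e eq = inc-complete e v (incident-end eq)

  sum-at : ∀ v (g : Fin nE → ℕ) → ℕΣ.sum (λ e → if incident G e v then g e else 0) ≡ ℕΣ.sum (g ∘ inc v)
  sum-at v = ℕΣ.sum-image _ (inc v) (inc-distinct v) (inc-incident v) (inc-cover v)

  sum²-at : ∀ v (g : Fin nE → Z2²) → ZΣ.sum (λ e → if incident G e v then g e else zero²) ≡ ZΣ.sum (g ∘ inc v)
  sum²-at v = ZΣ.sum-image _ (inc v) (inc-distinct v) (inc-incident v) (inc-cover v)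

  cubic : Cubic G
  cubic v = trans (count≡sum (λ e → incident G e v)) (sum-at v (λ _ → 1))

  cut : (Fin nV → Bool) → Fin nE → Bool
  cut X e = X (src e) xor X (tgt e)

  cutDegree : (Fin nV → Bool) → Fin nV → ℕ
  cutDegree X v = ℕΣ.sum (bit ∘ cut X ∘ inc v)

  Stable : (Fin nV → Bool) → Set
  Stable X = ∀ v → cutDegree X v ≤ 1

  flipAt : Fin nV → (Fin nV → Bool) → Fin nV → Bool
  flipAt v X w = if ⌊ w ≟ v ⌋ then not (X w) else X w

  flipAt-other : ∀ {v X w} → w ≢ v → flipAt v X w ≡ X w
  flipAt-other {v} {X} {w} w≢v = if-no (w ≟ v) w≢v

  cut-flip : ∀ X v e → cut (flipAt v X) e ≡ (if incident G e v then not (cut X e) else cut X e)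
  cut-flip X v e with src e ≟ v | tgt e ≟ v
  ... | yes p | yes q = ⊥-elim (loopless e (trans p (sym q)))
  ... | no _  | no _  = refl
  ... | yes _ | no _  with X (src e)
  ...   | true  = sym (not-involutive _)
  ...   | false = refl
  cut-flip X v e | no _ | yes _ with X (src e)
  ...   | true  = refl
  ...   | false = refl

  private
    away : (Fin nV → Bool) → Fin nV → ℕ
    away X v = ℕΣ.sum (λ e → if incident G e v then 0 else bit (cut X e))

  cutSize-at : ∀ X v → cutSize G X ≡ cutDegree X v + away X v
  cutSize-at X v = begin
    cutSize G X                ≡⟨ count≡sum (cut X) ⟩
    ℕΣ.sum (bit ∘ cut X)       ≡⟨ ℕΣ.sum-partition (λ e → incident G e v) (bit ∘ cut X) ⟩
    ℕΣ.sum (λ e → if incident G e v then bit (cut X e) else 0) + away X v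
                               ≡⟨ cong (_+ away X v) (sum-at v (bit ∘ cut X)) ⟩
    cutDegree X v + away X v   ∎
    where open ≡-Reasoning

  cutSize-flip : ∀ X v → cutSize G (flipAt v X) ≡ ℕΣ.sum (bit ∘ not ∘ cut X ∘ inc v) + away X v
  cutSize-flip X v = trans (cutSize-at (flipAt v X) v) (cong₂ _+_
    (ℕΣ.sum-cong-≗ λ j → cong bit (trans (cut-flip X v (inc v j))
      (cong (λ b → if b then not (cut X (inc v j)) else cut X (inc v j)) (inc-incident v j))))
    (ℕΣ.sum-cong-≗ same))
    where
    same : ∀ e → (if incident G e v then 0 else bit (cut (flipAt v X) e)) ≡ (if incident G e v then 0 else bit (cut X e))
    same e rewrite cut-flip X v e with incident G e v
    ... | true  = refl
    ... | false = refl

  -- Two or three of the three edges at `v` are cut, so at most one is after the move; edges away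
  -- from `v` keep their status.
  cutSize-flip-< : ∀ X v → 2 ≤ cutDegree X v → cutSize G (flipAt v X) < cutSize G X
  cutSize-flip-< X v 2≤ rewrite cutSize-flip X v | cutSize-at X v =
    +-monoˡ-< (away X v) (<-≤-trans (s≤s (flip-bits (cut X ∘ inc v) 2≤)) 2≤)

  cutDegree≤cutSize : ∀ X v → cutDegree X v ≤ cutSize G X
  cutDegree≤cutSize X v rewrite cutSize-at X v = m≤m+n _ _

  stable-of-two-uncut : ∀ X {v e e'} → e ≢ e' → End G e v → End G e' v →
    cut X e ≡ false → cut X e' ≡ false → cutDegree X v ≤ 1
  stable-of-two-uncut X {v} e≢e' end end' uncut uncut'
    with inc-complete _ v end | inc-complete _ v end'
  ... | j , refl | j' , refl = bits≤1 (cut X ∘ inc v) (e≢e' ∘ cong (inc v)) uncut uncut'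

  Joins : Fin nE → Fin nV → Fin nV → Set
  Joins e u w = (src e ≡ u × tgt e ≡ w) ⊎ (src e ≡ w × tgt e ≡ u)

  -- All that has to be remembered of a cycle. Unlike `HasCycleIn` it does not mention `X`, so it
  -- survives relabelling.
  Inner : List (Fin nV) → Fin nV → Set
  Inner L w = Σ (Fin nV) λ p → Σ (Fin nV) λ s → p ≢ s × p ∈ L × s ∈ L × Adj G p w × Adj G w s

  private
    joins-end : ∀ {e u w} → Joins e u w → End G e w
    joins-end (inj₁ (_ , q)) = inj₂ q
    joins-end (inj₂ (p , _)) = inj₁ p

    joins-sym : ∀ {e u w} → Joins e u w → Joins e w u
    joins-sym (inj₁ x) = inj₂ x
    joins-sym (inj₂ x) = inj₁ x

    joins-other : ∀ {e u u' w} → Joins e u w → Joins e u' w → u ≡ u'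
    joins-other (inj₁ (p , q)) (inj₁ (p' , q')) = trans (sym p) p'
    joins-other (inj₂ (p , q)) (inj₂ (p' , q')) = trans (sym q) q'
    joins-other (inj₁ (p , q)) (inj₂ (p' , q')) = ⊥-elim (loopless _ (trans p' (sym q)))
    joins-other (inj₂ (p , q)) (inj₁ (p' , q')) = ⊥-elim (loopless _ (trans p (sym q')))

    joins-uncut : ∀ {X e u w} → Joins e u w → X u ≡ X w → cut X e ≡ false
    joins-uncut {X} (inj₁ (refl , refl)) eq = xor-equal eq
    joins-uncut {X} (inj₂ (refl , refl)) eq = xor-equal (sym eq)

  -- The edges to the two neighbours are different, as `p` and `s` are, and uncut, as the list has
  -- one label; only the third edge at `w` can be cut. Hence no vertex of a one-label cycle is ever
  -- moved.
  inner-stable : ∀ {X c L w} → All (λ v → X v ≡ c) L → w ∈ L → Inner L w → cutDegree X w ≤ 1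
  inner-stable {X} onL w∈L (p , s , p≢s , p∈L , s∈L , (e , pw) , (e' , ws)) =
    stable-of-two-uncut X
      (λ e≡e' → p≢s (joins-other pw (subst (λ z → Joins z s _) (sym e≡e') (joins-sym ws))))
      (joins-end pw) (joins-end (joins-sym ws))
      (joins-uncut pw (same p∈L w∈L)) (joins-uncut ws (same w∈L s∈L))
    where
    same : ∀ {u v} → u ∈ _ → v ∈ _ → X u ≡ X v
    same u∈ v∈ = trans (All.lookup onL u∈) (sym (All.lookup onL v∈))

  private
    head≢ : ∀ {x y : Fin nV} {r} → Unique (x ∷ r) → y ∈ r → x ≢ y
    head≢ (x# ∷ _) y∈ = All.lookup x# y∈

    tail-unique : ∀ {x : Fin nV} {r} → Unique (x ∷ r) → Unique r
    tail-unique (_ ∷ u) = u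

    chain-last : ∀ {v} x r → AdjChain G (x ∷ r ++ v ∷ []) → Σ (Fin nV) λ l → l ∈ x ∷ r × Adj G l v
    chain-last x []       (a , _) = x , here refl , a
    chain-last x (y ∷ r)  (_ , c) with chain-last y r c
    ... | l , l∈ , a = l , there l∈ , a

    chain-inner : ∀ {v L} p x r → AdjChain G (p ∷ x ∷ r ++ v ∷ []) → Unique (p ∷ x ∷ r) →
      All (v ≢_) (x ∷ r) → (r ≡ [] → p ≢ v) → v ∈ L → (∀ {w} → w ∈ p ∷ x ∷ r → w ∈ L) →
      All (Inner L) (x ∷ r)
    chain-inner {v} p x [] (px , xv , _) u v# p≢v v∈ ⊆L =
      (p , v , p≢v refl , ⊆L (here refl) , v∈ , px , xv) ∷ []
    chain-inner p x (s ∷ r) (px , c@(xs , _)) u (v≢x ∷ v#) _ v∈ ⊆L =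
      (p , s , head≢ u (there (here refl)) , ⊆L (here refl) , ⊆L (there (there (here refl))) , px , xs)
      ∷ chain-inner x s r c (tail-unique u) v# (λ _ → v≢x ∘ sym) v∈ (⊆L ∘ there)

  cycle-inner : ∀ {X} ((v , rest , _) : HasCycleIn G X) → All (Inner (v ∷ rest)) (v ∷ rest)
  cycle-inner (v , x ∷ [] , s≤s () , _)
  cycle-inner (v , x ∷ y ∷ r , _ , u@(v# ∷ u') , _ , c@(vx , xc@(_ , yc))) with chain-last y r yc
  ... | l , l∈ , lv =
    (l , x , head≢ u' l∈ ∘ sym , there (there l∈) , there (here refl) , lv , vx)
    ∷ chain-inner v x (y ∷ r) c u v# (λ ()) (here refl) (λ w∈ → w∈)

  -- `large` no longer mentions cycles: stability and the presence of both labels suffice, which can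
  -- be examined pole by pole. Cyclic connectivity follows by moving vertices, 2-connectedness
  -- because a cut of at most one edge is automatically stable.
  module LargeStableCuts
    (large : ∀ X → Stable X → ∀ u v → X u ≡ true → X v ≡ false → 5 ≤ cutSize G X) where

    private
      all-inner-≢ : ∀ {X c L v} → All (λ w → X w ≡ c) L → All (Inner L) L → 2 ≤ cutDegree X v →
        ∀ {w} → w ∈ L → w ≢ v
      all-inner-≢ onL inner 2≤ w∈L refl = ≤⇒≯ (inner-stable onL w∈L (All.lookup inner w∈L)) 2≤

      after-flip : ∀ {X c L v} → All (λ w → X w ≡ c) L → All (Inner L) L → 2 ≤ cutDegree X v →
        All (λ w → flipAt v X w ≡ c) L
      after-flip {X} onL inner 2≤ = All.tabulate λ w∈L →
        trans (flipAt-other {X = X} (all-inner-≢ onL inner 2≤ w∈L)) (All.lookup onL w∈L)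

    -- A vertex with two cut edges can change sides: this shrinks the cut and keeps both cycles.
    cut-between-cycles : ∀ fuel X → cutSize G X ≤ fuel → ∀ {u L u' L'} →
      All (λ w → X w ≡ true) (u ∷ L) → All (Inner (u ∷ L)) (u ∷ L) →
      All (λ w → X w ≡ false) (u' ∷ L') → All (Inner (u' ∷ L')) (u' ∷ L') → 5 ≤ cutSize G X
    cut-between-cycles fuel X ≤fuel on inner off inner' with any? (λ v → 2 ≤? cutDegree X v)
    ... | no none = large X (λ v → ≤-pred (≰⇒> λ 2≤ → none (v , 2≤))) _ _ (All.head on) (All.head off)
    cut-between-cycles zero X ≤fuel on inner off inner' | yes (v , 2≤)
      with () ← ≤-trans (cutSize-flip-< X v 2≤) ≤fuel
    cut-between-cycles (suc fuel) X ≤fuel on inner off inner' | yes (v , 2≤) =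
      ≤-trans (cut-between-cycles fuel (flipAt v X) (≤-pred (≤-trans smaller ≤fuel))
        (after-flip on inner 2≤) inner (after-flip off inner' 2≤) inner')
        (≤-trans (m≤n+m _ 1) smaller)
      where smaller = cutSize-flip-< X v 2≤

    cyclically-5-connected : CyclicallyEdgeConnected G 5
    cyclically-5-connected X c@(_ , _ , _ , _ , on , _) c'@(_ , _ , _ , _ , off , _) =
      cut-between-cycles _ X ≤-refl (All.map T→≡true on) (cycle-inner {X} c)
        (All.map T-not→false off) (cycle-inner {not ∘ X} c')
      where
      T-not→false : ∀ {b} → T (not b) → b ≡ false
      T-not→false {false} _ = refl

    no-small-cut : ∀ X → cutSize G X ≤ 1 → ∀ u v → X u ≡ true → X v ≡ true
    no-small-cut X ≤1 u v Xu with X v in Xv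
    ... | true  = refl
    ... | false = ⊥-elim (≤⇒≯ ≤1 (≤-trans (s≤s (s≤s z≤n))
            (large X (λ w → ≤-trans (cutDegree≤cutSize X w) ≤1) u v Xu Xv)))

    private
      reach-snoc : ∀ {W u w z} → Reach G W u w → Adj G w z → T (W z) → Reach G W u z
      reach-snoc (here Wu)     wz Wz = step Wu wz (here Wz)
      reach-snoc (step Wu a r) wz Wz = step Wu a (reach-snoc r wz Wz)

      Leaves : (Fin nV → Bool) → (Fin nV → Bool) → Fin nE → Set
      Leaves W R e = (R (src e) ≡ true × R (tgt e) ≡ false × W (tgt e) ≡ true)
                   ⊎ (R (tgt e) ≡ true × R (src e) ≡ false × W (src e) ≡ true)

      leaves? : ∀ W R e → Dec (Leaves W R e)
      leaves? W R e = ((R (src e) ≟ᵇ true) ×-dec (R (tgt e) ≟ᵇ false) ×-dec (W (tgt e) ≟ᵇ true))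
                 ⊎-dec ((R (tgt e) ≟ᵇ true) ×-dec (R (src e) ≟ᵇ false) ×-dec (W (src e) ≟ᵇ true))

      ≡true→T : ∀ {b} → b ≡ true → T b
      ≡true→T refl = tt

    -- The set R of vertices reached inside W is grown until no edge of W leaves it.
    module _ (W : Fin nV → Bool) (u : Fin nV)
      (closed-full : ∀ R → R u ≡ true → (∀ w → R w ≡ true → W w ≡ true) → (∀ e → ¬ Leaves W R e) →
        ∀ v → W v ≡ true → R v ≡ true) where

      grow : ∀ fuel R → count (not ∘ R) ≤ fuel → R u ≡ true →
        (∀ w → R w ≡ true → Reach G W u w) → (∀ w → R w ≡ true → W w ≡ true) →
        ∀ v → W v ≡ true → Reach G W u v
      grow fuel R ≤fuel Ru reached R⊆W v Wv with any? (leaves? W R)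
      ... | no none = reached v (closed-full R Ru R⊆W (λ e l → none (e , l)) v Wv)
      ... | yes (e , l) = add fuel ≤fuel (new l)
        where
        New : Fin nV → Set
        New z = R z ≡ false × W z ≡ true × Reach G W u z
        new : Leaves W R e → Σ (Fin nV) New
        new (inj₁ (Rs , ¬Rt , Wt)) = tgt e , ¬Rt , Wt , reach-snoc (reached _ Rs) (e , inj₁ (refl , refl)) (≡true→T Wt)
        new (inj₂ (Rt , ¬Rs , Ws)) = src e , ¬Rs , Ws , reach-snoc (reached _ Rt) (e , inj₂ (refl , refl)) (≡true→T Ws)
        module _ {z : Fin nV} (fresh : New z) where
          R' : Fin nV → Bool
          R' w = if ⌊ w ≟ z ⌋ then true else R w
          R'-cases : ∀ (P : Fin nV → Set) → P z → (∀ w → R w ≡ true → P w) → ∀ w → R' w ≡ true → P w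
          R'-cases P Pz PR w eq with w ≟ z
          ... | yes refl = Pz
          ... | no _     = PR w eq
          R'u : R' u ≡ true
          R'u with u ≟ z
          ... | yes _ = refl
          ... | no _  = Ru
          fewer : count (not ∘ R) ≡ suc (count (not ∘ R'))
          fewer = begin
            count (not ∘ R)                        ≡⟨ count≡sum (not ∘ R) ⟩
            ℕΣ.sum (bit ∘ not ∘ R)                 ≡⟨ ℕΣ.sum-cong-≗ pointwise ⟩
            ℕΣ.sum (λ w → (if ⌊ w ≟ z ⌋ then 1 else 0) + bit (not (R' w)))
                                                   ≡⟨ ℕΣ.∑-distrib-+ (λ w → if ⌊ w ≟ z ⌋ then 1 else 0) _ ⟩
            ℕΣ.sum (λ w → if ⌊ w ≟ z ⌋ then 1 else 0) + ℕΣ.sum (bit ∘ not ∘ R')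
                                                   ≡⟨ cong₂ _+_ (ℕΣ.sum-δ z (λ _ → 1)) (sym (count≡sum (not ∘ R'))) ⟩
            suc (count (not ∘ R'))                 ∎
            where
            open ≡-Reasoning
            pointwise : ∀ w → bit (not (R w)) ≡ (if ⌊ w ≟ z ⌋ then 1 else 0) + bit (not (R' w))
            pointwise w with w ≟ z
            ... | yes refl rewrite proj₁ fresh = refl
            ... | no _     = refl
        add : ∀ fuel → count (not ∘ R) ≤ fuel → Σ (Fin nV) New → Reach G W u v
        add zero    ≤0 (z , n) with () ← subst (_≤ 0) (fewer n) ≤0
        add (suc k) ≤k (z , n@(_ , Wz , ruz)) =
          grow k (R' n) (≤-pred (subst (_≤ suc k) (fewer n) ≤k)) (R'u n)
            (R'-cases n (Reach G W u) ruz reached) (R'-cases n (λ w → W w ≡ true) Wz R⊆W) v Wv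

      reach-all : W u ≡ true → ∀ v → W v ≡ true → Reach G W u v
      reach-all Wu = grow _ (λ w → ⌊ w ≟ u ⌋) ≤-refl ≟-refl (only (Reach G W u) (here (≡true→T Wu))) (only (λ w → W w ≡ true) Wu)
        where
        ≟-refl : ⌊ u ≟ u ⌋ ≡ true
        ≟-refl with u ≟ u
        ... | yes _ = refl
        ... | no u≢ = ⊥-elim (u≢ refl)
        only : ∀ (P : Fin nV → Set) → P u → ∀ w → ⌊ w ≟ u ⌋ ≡ true → P w
        only P Pu w eq with w ≟ u
        ... | yes refl = Pu

    connected : ConnectedOn G (λ _ → true)
    connected u v _ _ = reach-all (λ _ → true) u closed-full refl v refl
      where
      closed-full : ∀ R → R u ≡ true → _ → (∀ e → ¬ Leaves (λ _ → true) R e) → ∀ v → _ → R v ≡ true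
      closed-full R Ru _ closed v _ = no-small-cut R (subst (_≤ 1) (sym cut≡0) z≤n) u v Ru
        where
        uncut : ∀ e → cut R e ≡ false
        uncut e with R (src e) in s | R (tgt e) in t
        ... | true  | true  = refl
        ... | false | false = refl
        ... | true  | false = ⊥-elim (closed e (inj₁ (s , t , refl)))
        ... | false | true  = ⊥-elim (closed e (inj₂ (t , s , refl)))
        cut≡0 : cutSize G R ≡ 0
        cut≡0 = trans (count≡sum (cut R)) (ℕΣ.sum-ε (λ e → cong bit (uncut e)))

    -- If `R` is closed in the graph without `x`, all its cut edges meet `x`. Should there be two or
    -- three of them, moving `x` across leaves at most one, so one of the two labellings has a cut
    -- too small to separate anything.
    connected-minus : ∀ x → ConnectedOn G (λ v → not ⌊ v ≟ x ⌋)
    connected-minus x u v Wu Wv = reach-all W u closed-full (T→≡true Wu) v (T→≡true Wv)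
      where
      W : Fin nV → Bool
      W v = not ⌊ v ≟ x ⌋
      W-≢ : ∀ {v} → W v ≡ true → v ≢ x
      W-≢ {v} eq with v ≟ x
      ... | no v≢x = v≢x
      ≢-W : ∀ {v} → v ≢ x → W v ≡ true
      ≢-W {v} v≢x with v ≟ x
      ... | yes v≡x = ⊥-elim (v≢x v≡x)
      ... | no _    = refl
      uncut-away : ∀ R → (∀ e → ¬ Leaves W R e) → away R x ≡ 0
      uncut-away R closed = ℕΣ.sum-ε pointwise
        where
        pointwise : ∀ e → (if incident G e x then 0 else bit (cut R e)) ≡ 0
        pointwise e with src e ≟ x | tgt e ≟ x
        ... | yes _ | _     = refl
        ... | no _  | yes _ = refl
        ... | no s≢ | no t≢ with R (src e) in s | R (tgt e) in t
        ...   | true  | true  = refl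
        ...   | false | false = refl
        ...   | true  | false = ⊥-elim (closed e (inj₁ (s , t , ≢-W t≢)))
        ...   | false | true  = ⊥-elim (closed e (inj₂ (t , s , ≢-W s≢)))
      closed-full : ∀ R → R u ≡ true → (∀ w → R w ≡ true → W w ≡ true) → (∀ e → ¬ Leaves W R e) →
        ∀ v → W v ≡ true → R v ≡ true
      closed-full R Ru R⊆W closed v Wv with 2 ≤? cutDegree R x
      ... | no 2≰ = no-small-cut R (subst (_≤ 1) (sym small) (≤-pred (≰⇒> 2≰))) u v Ru
        where
        small : cutSize G R ≡ cutDegree R x
        small = trans (cutSize-at R x) (trans (cong (cutDegree R x +_) (uncut-away R closed)) (+-identityʳ _))
      ... | yes 2≤ = trans (sym (flipAt-other {X = R} (W-≢ Wv)))
          (no-small-cut (flipAt x R) (subst (_≤ 1) (sym small) (flip-bits (cut R ∘ inc x) 2≤)) u v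
            (trans (flipAt-other {X = R} (W-≢ (T→≡true Wu))) Ru))
        where
        small : cutSize G (flipAt x R) ≡ ℕΣ.sum (bit ∘ not ∘ cut R ∘ inc x)
        small = trans (cutSize-flip R x) (trans (cong (ℕΣ.sum (bit ∘ not ∘ cut R ∘ inc x) +_) (uncut-away R closed)) (+-identityʳ _))

    two-connected : 3 ≤ nV → TwoConnected G
    two-connected 3≤nV = 3≤nV , connected , connected-minus

-- Flows with values in the Klein four-group, and edge colourings

_≟²_ : (x y : Z2²) → Dec (x ≡ y)
_≟²_ = ≡-dec _≟ᵇ_ _≟ᵇ_

colour : Fin 3 → Z2²
colour zero             = false , true
colour (suc zero)       = true , false
colour (suc (suc zero)) = true , true

colour≢0 : ∀ c → colour c ≢ zero²
colour≢0 zero ()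
colour≢0 (suc zero) ()
colour≢0 (suc (suc zero)) ()

colour-sum : ∀ a b c → a ≢ b → a ≢ c → b ≢ c → (colour a ⊕ (colour b ⊕ (colour c ⊕ zero²))) ≡ zero²
colour-sum = toWitness {a? = all? λ a → all? λ b → all? λ c →
  ¬? (a ≟ b) →-dec ¬? (a ≟ c) →-dec ¬? (b ≟ c) →-dec ((colour a ⊕ (colour b ⊕ (colour c ⊕ zero²))) ≟² zero²)} _

-- For a vertex with one masked edge: the zero summand computes away wherever it stands, so this
-- form serves all three positions.
colour-pair : ∀ a b → a ≢ b → (colour a ⊕ (colour b ⊕ zero²)) ≢ zero²
colour-pair = toWitness {a? = all? λ a → all? λ b →
  ¬? (a ≟ b) →-dec ¬? ((colour a ⊕ (colour b ⊕ zero²)) ≟² zero²)} _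

if-swap : ∀ {A : Set} (b b' : Bool) {x y : A} →
  (if b then (if b' then x else y) else y) ≡ (if b' then (if b then x else y) else y)
if-swap true  true  = refl
if-swap true  false = refl
if-swap false true  = refl
if-swap false false = refl

module Flows (G : Graph) (I : Incidences G) where
  open Graph G
  open Incidences I
  open CubicGraph G I

  net : (Fin nE → Z2²) → Fin nV → Z2²
  net g v = ZΣ.sum (g ∘ inc v)

  mask : (Fin nE → Bool) → (Fin nE → Z2²) → Fin nE → Z2²
  mask S f e = if S e then zero² else f e

  sum²-mask : ∀ S f v → sum² (λ e → if incident G e v ∧ not (S e) then f e else zero²) ≡ net (mask S f) v
  sum²-mask S f v = trans (sum²≡sum _) (trans (ZΣ.sum-cong-≗ pointwise) (sum²-at v (mask S f)))
    where
    pointwise : ∀ e → (if incident G e v ∧ not (S e) then f e else zero²) ≡ (if incident G e v then mask S f e else zero²)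
    pointwise e with incident G e v | S e
    ... | true  | true  = refl
    ... | true  | false = refl
    ... | false | _     = refl

  -- Exchanging the sums collects each edge once for every end in `X`. With both ends in `X` it
  -- cancels in characteristic two, and only the cut edges remain.
  net-across-cut : ∀ X g →
    ZΣ.sum (λ v → if X v then net g v else zero²) ≡ ZΣ.sum (λ e → if cut X e then g e else zero²)
  net-across-cut X g = begin
    ZΣ.sum (λ v → if X v then net g v else zero²)
      ≡⟨ ZΣ.sum-cong-≗ (λ v → expand v) ⟩
    ZΣ.sum (λ v → ZΣ.sum (λ e → at-v e v))
      ≡⟨ ZΣ.∑-comm (λ v e → at-v e v) ⟩
    ZΣ.sum (λ e → ZΣ.sum (λ v → at-v e v))
      ≡⟨ ZΣ.sum-cong-≗ collect ⟩
    ZΣ.sum (λ e → if cut X e then g e else zero²) ∎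
    where
    open ≡-Reasoning
    at-v : Fin nE → Fin nV → Z2²
    at-v e v = if X v then (if incident G e v then g e else zero²) else zero²
    at-end : Fin nE → Fin nV → Fin nV → Z2²
    at-end e w v = if ⌊ v ≟ w ⌋ then (if X v then g e else zero²) else zero²
    expand : ∀ v → (if X v then net g v else zero²) ≡ ZΣ.sum (λ e → at-v e v)
    expand v with X v
    ... | true  = sym (sum²-at v g)
    ... | false = sym (ZΣ.sum-ε {f = λ (e : Fin nE) → zero²} (λ _ → refl))
    ends : ∀ e v → at-v e v ≡ (at-end e (src e) v ⊕ at-end e (tgt e) v)
    ends e v with src e ≟ v | tgt e ≟ v | v ≟ src e | v ≟ tgt e
    ... | yes p | yes q | _ | _ = ⊥-elim (loopless e (trans p (sym q)))
    ... | yes p | no q | yes _ | no _ = sym (⊕-identityʳ _)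
    ... | no p | yes q | no _ | yes _ = refl
    ... | no p | no q | no _ | no _ with X v
    ...   | true  = refl
    ...   | false = refl
    ends e v | yes p | _ | no r | _ = ⊥-elim (r (sym p))
    ends e v | no p | _ | yes r | _ = ⊥-elim (p (sym r))
    ends e v | _ | yes p | _ | no r = ⊥-elim (r (sym p))
    ends e v | _ | no p | _ | yes r = ⊥-elim (p (sym r))
    merge : ∀ a b (x : Z2²) → ((if a then x else zero²) ⊕ (if b then x else zero²)) ≡ (if a xor b then x else zero²)
    merge true  true  x = ⊕-self x
    merge true  false x = ⊕-identityʳ x
    merge false b     x = refl
    collect : ∀ e → ZΣ.sum (λ v → at-v e v) ≡ (if cut X e then g e else zero²)
    collect e = trans (ZΣ.sum-cong-≗ (ends e)) (trans (ZΣ.∑-distrib-+ (at-end e (src e)) (at-end e (tgt e)))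
      (trans (cong₂ _⊕_ (ZΣ.sum-δ (src e) (λ v → if X v then g e else zero²))
                        (ZΣ.sum-δ (tgt e) (λ v → if X v then g e else zero²)))
             (merge (X (src e)) (X (tgt e)) (g e))))

  net-total : ∀ g → ZΣ.sum (net g) ≡ zero²
  net-total g = trans (net-across-cut (λ _ → true) g) (ZΣ.sum-ε {f = λ (e : Fin nE) → zero²} (λ _ → refl))

  -- By the parity lemma, a colouring that misses one edge extends to it.
  module _ (no-flow : ∀ f → (∀ e → f e ≢ zero²) → ¬ (∀ v → net f v ≡ zero²)) where

    module _ (S : Fin nE → Bool) (coloured : ColorableMinus G S) where

      private
        c : Fin nE → Fin 3
        c = proj₁ coloured

        g : Fin nE → Z2²
        g = mask S (colour ∘ c)

        g-kept : ∀ {e} → S e ≡ false → g e ≡ colour (c e)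
        g-kept eq rewrite eq = refl

        differ : ∀ v {j j'} → j ≢ j' → S (inc v j) ≡ false → S (inc v j') ≡ false → c (inc v j) ≢ c (inc v j')
        differ v j≢j' ¬S ¬S' = proj₂ coloured _ _ (j≢j' ∘ inc-distinct v) ¬S ¬S'
          (v , T-end (inc-sound v _) , T-end (inc-sound v _))
          where
          T-end : ∀ {e} → End G e v → T (incident G e v)
          T-end end rewrite incident-yes end = _

        balanced : ∀ v → (∀ j → S (inc v j) ≡ false) → net g v ≡ zero²
        balanced v ¬S rewrite ¬S zero | ¬S (suc zero) | ¬S (suc (suc zero)) =
          colour-sum _ _ _ (differ v (λ ()) (¬S _) (¬S _)) (differ v (λ ()) (¬S _) (¬S _)) (differ v (λ ()) (¬S _) (¬S _))

        unbalanced : ∀ v j → S (inc v j) ≡ true → (∀ j' → j' ≢ j → S (inc v j') ≡ false) → net g v ≢ zero²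
        unbalanced v zero Sj ¬S rewrite Sj | ¬S (suc zero) (λ ()) | ¬S (suc (suc zero)) (λ ()) =
          colour-pair _ _ (differ v (λ ()) (¬S _ λ ()) (¬S _ λ ()))
        unbalanced v (suc zero) Sj ¬S rewrite Sj | ¬S zero (λ ()) | ¬S (suc (suc zero)) (λ ()) =
          colour-pair _ _ (differ v (λ ()) (¬S _ λ ()) (¬S _ λ ()))
        unbalanced v (suc (suc zero)) Sj ¬S rewrite Sj | ¬S zero (λ ()) | ¬S (suc zero) (λ ()) =
          colour-pair _ _ (differ v (λ ()) (¬S _ λ ()) (¬S _ λ ()))

      module _ (e₀ : Fin nE) (Se₀ : S e₀ ≡ true) (only : ∀ e → S e ≡ true → e ≡ e₀) where
        private
          ¬S : ∀ {e} → e ≢ e₀ → S e ≡ false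
          ¬S {e} e≢ with S e in eq
          ... | true  = ⊥-elim (e≢ (only e eq))
          ... | false = refl

          s t : Fin nV
          s = src e₀
          t = tgt e₀

          d : Z2²
          d = net g s

          d≢0 : d ≢ zero²
          d≢0 with inc-complete e₀ s (inj₁ refl)
          ... | j , eq = unbalanced s j (trans (cong S eq) Se₀)
                  (λ j' j'≢j → ¬S (λ eq' → j'≢j (inc-distinct s (trans eq' (sym eq)))))

          elsewhere : ∀ {v} → ¬ End G e₀ v → net g v ≡ zero²
          elsewhere {v} ¬end = balanced v (λ j → ¬S (λ eq → ¬end (subst (λ e → End G e v) eq (inc-sound v j))))

          -- `net g` vanishes away from the ends of `e₀` and its total is zero, so both ends have
          -- the same imbalance `d`; the value `d` on `e₀` repairs both.
          two-ends : (d ⊕ net g t) ≡ zero²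
          two-ends = begin
            d ⊕ net g t     ≡⟨ cong₂ _⊕_ (ZΣ.sum-δ s (net g)) (ZΣ.sum-δ t (net g)) ⟨
            ZΣ.sum (λ v → if ⌊ v ≟ s ⌋ then net g v else zero²) ⊕ ZΣ.sum (λ v → if ⌊ v ≟ t ⌋ then net g v else zero²)
                            ≡⟨ ZΣ.∑-distrib-+ (λ v → if ⌊ v ≟ s ⌋ then net g v else zero²) _ ⟨
            ZΣ.sum (λ v → (if ⌊ v ≟ s ⌋ then net g v else zero²) ⊕ (if ⌊ v ≟ t ⌋ then net g v else zero²))
                            ≡⟨ ZΣ.sum-cong-≗ pointwise ⟨
            ZΣ.sum (net g)  ≡⟨ net-total g ⟩
            zero²           ∎
            where
            open ≡-Reasoning
            pointwise : ∀ v → net g v ≡ ((if ⌊ v ≟ s ⌋ then net g v else zero²) ⊕ (if ⌊ v ≟ t ⌋ then net g v else zero²))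
            pointwise v with v ≟ s | v ≟ t
            ... | yes p | yes q = ⊥-elim (loopless e₀ (trans (sym p) q))
            ... | yes p | no q  = sym (⊕-identityʳ _)
            ... | no p  | yes q = refl
            ... | no p  | no q  = elsewhere [ p ∘ sym , q ∘ sym ]′

          f δ : Fin nE → Z2²
          δ e = if ⌊ e ≟ e₀ ⌋ then d else zero²
          f e = g e ⊕ δ e

          f≢0 : ∀ e → f e ≢ zero²
          f≢0 e with e ≟ e₀
          ... | yes refl rewrite Se₀ = d≢0
          ... | no e≢ rewrite ¬S e≢ = colour≢0 (c e) ∘ trans (sym (⊕-identityʳ _))

          net-δ : ∀ v → net δ v ≡ (if incident G e₀ v then d else zero²)
          net-δ v = trans (sym (sum²-at v δ)) (trans (ZΣ.sum-cong-≗ (λ e → if-swap (incident G e v) ⌊ e ≟ e₀ ⌋))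
            (ZΣ.sum-δ e₀ (λ e → if incident G e v then d else zero²)))

          net-f : ∀ v → net f v ≡ zero²
          net-f v = trans (ZΣ.∑-distrib-+ (g ∘ inc v) (δ ∘ inc v)) (trans (cong (net g v ⊕_) (net-δ v)) cases)
            where
            cases : (net g v ⊕ (if incident G e₀ v then d else zero²)) ≡ zero²
            cases with src e₀ ≟ v | tgt e₀ ≟ v
            ... | yes refl | _        = ⊕-self d
            ... | no _     | yes refl = trans (⊕-comm (net g t) d) two-ends
            ... | no p     | no q     = trans (⊕-identityʳ _) (elsewhere [ p , q ]′)

        one-edge-impossible : ⊥
        one-edge-impossible = no-flow f f≢0 net-f

      2≤missing : 2 ≤ count S
      2≤missing with any? (λ e → S e ≟ᵇ true)
      ... | no none = ⊥-elim (no-flow (colour ∘ c) (colour≢0 ∘ c) λ v →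
              trans (ZΣ.sum-cong-≗ (λ j → sym (g-kept (¬S (inc v j))))) (balanced v (λ j → ¬S _)))
        where
        ¬S : ∀ e → S e ≡ false
        ¬S e with S e in eq
        ... | true  = ⊥-elim (none (e , eq))
        ... | false = refl
      ... | yes (e₀ , Se₀) with any? (λ e → (S e ≟ᵇ true) ×-dec ¬? (e ≟ e₀))
      ...   | yes (e , Se , e≢) = subst (2 ≤_) (sym (count≡sum S))
                (≤-trans (≤-reflexive (sym (cong₂ _+_ (cong bit Se) (cong bit Se₀)))) (terms≤sum (bit ∘ S) e≢))
      ...   | no none = ⊥-elim (one-edge-impossible e₀ Se₀ unique)
        where
        unique : ∀ e → S e ≡ true → e ≡ e₀
        unique e Se with e ≟ e₀
        ... | yes p = p
        ... | no ¬p = ⊥-elim (none (e , Se , ¬p))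

    not-colourable : ¬ ThreeEdgeColorable G
    not-colourable col with () ← ≤-trans (2≤missing (λ _ → false) col)
      (≤-reflexive (trans (count≡sum {nE} (λ _ → false)) (ℕΣ.sum-ε {nE} {λ _ → 0} (λ _ → refl))))

-- Exhaustive search with pruning

true-≤ : ∀ {m n} → (m ≤ᵇ n) ≡ true → m ≤ n
true-≤ {m} {n} eq = ≤ᵇ⇒≤ m n (subst T (sym eq) tt)

∧-true : ∀ {a b} → a ∧ b ≡ true → a ≡ true × b ≡ true
∧-true {true} {true} refl = refl , refl

-- A partial assignment ρ is refined variable by variable; weight ρ t must be a lower bound for
-- the cost of the term t at every total assignment that extends ρ.
module Search {D Term : Set} {n : ℕ} (values : List D) (weight : Vec (Maybe D) n → Term → ℕ)
  (budget : ℕ) (accept : Vec (Maybe D) n → ℕ → Bool) where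

  -- The order of branching and weighing is fixed in advance and does not depend on the values
  -- chosen, so one list `terms` accounts for the costs along every branch.
  data Instruction : Set where
    branch : Fin n → Instruction
    weigh  : Term → Instruction

  terms : List Instruction → List Term
  terms []              = []
  terms (branch _ ∷ is) = terms is
  terms (weigh t ∷ is)  = t ∷ terms is

  search   : List Instruction → Vec (Maybe D) n → ℕ → Bool
  branches : List D → Fin n → List Instruction → Vec (Maybe D) n → ℕ → Bool
  prune    : ℕ → List Instruction → Vec (Maybe D) n → Bool
  search []              ρ k = accept ρ k
  search (branch v ∷ is) ρ k = branches values v is ρ k
  search (weigh t ∷ is)  ρ k = prune (weight ρ t + k) is ρ
  branches []       v is ρ k = true
  branches (d ∷ ds) v is ρ k = search is (ρ [ v ]≔ just d) k ∧ branches ds v is ρ k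
  prune k is ρ = if budget ≤ᵇ k then true else search is ρ k

  Agrees : Vec (Maybe D) n → (Fin n → D) → Set
  Agrees ρ x = ∀ v {d} → lookup ρ v ≡ just d → x v ≡ d

  agrees-nothing : ∀ {x} → Agrees (replicate n nothing) x
  agrees-nothing v eq rewrite lookup-replicate v (nothing {A = D}) with () ← eq

  agrees-update : ∀ {ρ x} v → Agrees ρ x → Agrees (ρ [ v ]≔ just (x v)) x
  agrees-update {ρ} {x} v agrees w eq with w ≟ v
  ... | yes refl = just-injective (trans (sym (lookup∘update v ρ _)) eq)
  ... | no w≢v   = agrees w (trans (sym (lookup∘update′ w≢v ρ _)) eq)

  module _ (x : Fin n → D) (x∈values : ∀ v → x v ∈ values) (cost : Term → ℕ)
    (weight≤cost : ∀ {ρ} → Agrees ρ x → ∀ t → weight ρ t ≤ cost t) where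

    costs : List Term → ℕ
    costs []       = 0
    costs (t ∷ ts) = cost t + costs ts

    -- The second case keeps the recorded weight `k` of the leaf, because `accept` may ask for a
    -- minimal weight.
    Outcome : ℕ → Set
    Outcome m = budget ≤ m ⊎ Σ (Vec (Maybe D) n) λ ρ → Σ ℕ λ k → Agrees ρ x × accept ρ k ≡ true × k ≤ m

    outcome-mono : ∀ {m m'} → m ≤ m' → Outcome m → Outcome m'
    outcome-mono m≤m' (inj₁ b)                 = inj₁ (≤-trans b m≤m')
    outcome-mono m≤m' (inj₂ (ρ , k , a , o , l)) = inj₂ (ρ , k , a , o , ≤-trans l m≤m')

    search-sound : ∀ is {ρ k} → Agrees ρ x → search is ρ k ≡ true → Outcome (costs (terms is) + k)
    branches-sound : ∀ ds v is {ρ k} → x v ∈ ds → Agrees ρ x → branches ds v is ρ k ≡ true → Outcome (costs (terms is) + k)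
    search-sound []              agrees eq = inj₂ (_ , _ , agrees , eq , ≤-refl)
    search-sound (branch v ∷ is) agrees eq = branches-sound values v is (x∈values v) agrees eq
    search-sound (weigh t ∷ is) {ρ} {k} agrees eq with budget ≤ᵇ (weight ρ t + k) in over
    ... | true  = inj₁ (≤-trans (true-≤ over)
                    (+-monoˡ-≤ k (≤-trans (weight≤cost agrees t) (m≤m+n _ _))))
    ... | false = outcome-mono
      (≤-trans (+-monoʳ-≤ (costs (terms is)) (+-monoˡ-≤ k (weight≤cost agrees t)))
        (≤-reflexive (trans (sym (+-assoc (costs (terms is)) (cost t) k)) (cong (_+ k) (+-comm (costs (terms is)) (cost t))))))
      (search-sound is agrees eq)
    branches-sound (d ∷ ds) v is {ρ} (here refl)  agrees eq =
      search-sound is (agrees-update {ρ} v agrees) (proj₁ (∧-true eq))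
    branches-sound (d ∷ ds) v is {ρ} {k} (there x∈) agrees eq =
      branches-sound ds v is x∈ agrees (proj₂ (∧-true {search is (ρ [ v ]≔ just d) k} eq))

-- Each step blanks the index just paid for, which the rest of the list avoids. A program that
-- weighs every edge at most once therefore never charges more than the whole cut.
costs-unique : ∀ {n} (g : Fin n → ℕ) {l : List (Fin n)} → Unique l → foldr (λ i → g i +_) 0 l ≤ ℕΣ.sum g
costs-unique g [] = z≤n
costs-unique {n} g {i ∷ l} (i# ∷ u) = begin
  g i + foldr (λ j → g j +_) 0 l    ≡⟨ cong (g i +_) (same l i#) ⟩
  g i + foldr (λ j → g' j +_) 0 l   ≤⟨ +-monoʳ-≤ (g i) (costs-unique g' u) ⟩
  g i + ℕΣ.sum g'                             ≡⟨ cong (_+ ℕΣ.sum g') (ℕΣ.sum-δ i g) ⟨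
  ℕΣ.sum (λ j → if ⌊ j ≟ i ⌋ then g j else 0) + ℕΣ.sum g'
                                              ≡⟨ ℕΣ.sum-partition (λ j → ⌊ j ≟ i ⌋) g ⟨
  ℕΣ.sum g                                    ∎
  where
  open ≤-Reasoning
  g' : Fin n → ℕ
  g' j = if ⌊ j ≟ i ⌋ then 0 else g j
  same : ∀ l → All (i ≢_) l → foldr (λ j → g j +_) 0 l ≡ foldr (λ j → g' j +_) 0 l
  same []      []         = refl
  same (j ∷ l) (i≢j ∷ i#) = cong₂ _+_ (sym (if-no (j ≟ i) (i≢j ∘ sym))) (same l i#)

-- Poles with three in-edges and three out-edges

record Pole : Set where
  field
    nv ni  : ℕ
    ends   : Fin ni → Fin nv × Fin nv
    inp    : Fin 3 → Fin nv
    outp   : Fin 3 → Fin nv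
    -- Local edges: three in-edges, then the internal edges, then three out-edges.
    star   : Fin nv → Fin 3 → Fin ((3 + ni) + 3)

  -- A connector belongs to the pole it enters, so every edge of the ring has exactly one owner and
  -- counts can be made pole by pole.
  Own Local : Set
  Own   = Fin (3 + ni)
  Local = Fin ((3 + ni) + 3)

  data Place : Set where
    before after : Fin 3 → Place
    inside       : Fin nv → Place

  local-tail local-head : Local → Place
  own-tail own-head : Own → Place
  own-tail = [ before , inside ∘ proj₁ ∘ ends ]′ ∘ splitAt 3
  own-head = [ inside ∘ inp , inside ∘ proj₂ ∘ ends ]′ ∘ splitAt 3
  local-tail = [ own-tail , inside ∘ outp ]′ ∘ splitAt (3 + ni)
  local-head = [ own-head , after ]′ ∘ splitAt (3 + ni)

module PoleTheory (P : Pole) where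
  open Pole P

  _≟ᵖ_ : (a b : Place) → Dec (a ≡ b)
  before p ≟ᵖ before q with p ≟ q
  ... | yes refl = yes refl
  ... | no ¬p    = no λ { refl → ¬p refl }
  after p ≟ᵖ after q with p ≟ q
  ... | yes refl = yes refl
  ... | no ¬p    = no λ { refl → ¬p refl }
  inside p ≟ᵖ inside q with p ≟ q
  ... | yes refl = yes refl
  ... | no ¬p    = no λ { refl → ¬p refl }
  before _ ≟ᵖ after _  = no λ ()
  before _ ≟ᵖ inside _ = no λ ()
  after _  ≟ᵖ before _ = no λ ()
  after _  ≟ᵖ inside _ = no λ ()
  inside _ ≟ᵖ before _ = no λ ()
  inside _ ≟ᵖ after _  = no λ ()

  Touches : Local → Fin nv → Set
  Touches e v = local-tail e ≡ inside v ⊎ local-head e ≡ inside v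

  -- An end outside the pole is covered by the same condition on the neighbouring pole, where it is
  -- inside.
  Listed : Local → Place → Set
  Listed e (before _) = ⊤
  Listed e (after _)  = ⊤
  Listed e (inside v) = Σ (Fin 3) λ j → star v j ≡ e

  listed? : ∀ e a → Dec (Listed e a)
  listed? e (before _) = yes tt
  listed? e (after _)  = yes tt
  listed? e (inside v) = any? λ j → star v j ≟ e

  SameEnds : Fin ni → Fin ni → Set
  SameEnds k l = (proj₁ (ends k) ≡ proj₁ (ends l) × proj₂ (ends k) ≡ proj₂ (ends l))
               ⊎ (proj₁ (ends k) ≡ proj₂ (ends l) × proj₂ (ends k) ≡ proj₁ (ends l))

  -- The third condition excludes parallel edges in a ring of two poles, where both connectors join
  -- the same two poles; the fourth excludes them within one connector.
  WellFormed : Set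
  WellFormed =
      (∀ k → proj₁ (ends k) ≢ proj₂ (ends k))
    × (∀ k l → SameEnds k l → k ≡ l)
    × (∀ p q → inp p ≢ outp q)
    × (∀ p q → outp p ≡ outp q → p ≡ q)
    × (∀ v i j → star v i ≡ star v j → i ≡ j)
    × (∀ v j → Touches (star v j) v)
    × (∀ e → Listed e (local-tail e) × Listed e (local-head e))

  wellFormed? : Dec WellFormed
  wellFormed? =
          (all? λ k → ¬? (proj₁ (ends k) ≟ proj₂ (ends k)))
    ×-dec (all? λ k → all? λ l →
            (((proj₁ (ends k) ≟ proj₁ (ends l)) ×-dec (proj₂ (ends k) ≟ proj₂ (ends l)))
              ⊎-dec ((proj₁ (ends k) ≟ proj₂ (ends l)) ×-dec (proj₂ (ends k) ≟ proj₁ (ends l)))) →-dec (k ≟ l))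
    ×-dec (all? λ p → all? λ q → ¬? (inp p ≟ outp q))
    ×-dec (all? λ p → all? λ q → (outp p ≟ outp q) →-dec (p ≟ q))
    ×-dec (all? λ v → all? λ i → all? λ j → (star v i ≟ star v j) →-dec (i ≟ j))
    ×-dec (all? λ v → all? λ j → (local-tail (star v j) ≟ᵖ inside v) ⊎-dec (local-head (star v j) ≟ᵖ inside v))
    ×-dec (all? λ e → listed? e (local-tail e) ×-dec listed? e (local-head e))

  record Labelling : Set where
    field
      left right : Fin 3 → Bool
      label      : Fin nv → Bool

    value : Place → Bool
    value (before p) = left p
    value (after p)  = right p
    value (inside v) = label v

    cutAt : Local → Bool
    cutAt e = value (local-tail e) xor value (local-head e)

    LocallyStable : Set
    LocallyStable = ∀ v → ℕΣ.sum (bit ∘ cutAt ∘ star v) ≤ 1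

    innerCut : ℕ
    innerCut = ℕΣ.sum λ k → bit (label (proj₁ (ends k)) xor label (proj₂ (ends k)))

    fullCut : ℕ
    fullCut = ℕΣ.sum (bit ∘ cutAt)

    Constant : Set
    Constant = Σ Bool λ c → ∀ v → label v ≡ c

    -- If the next pole is constant, it then disagrees with some out-vertex, and an edge of the
    -- connector is cut.
    MixedOut : Set
    MixedOut = ¬ (Σ Bool λ c → ∀ p → label (outp p) ≡ c)

  open Labelling

  data Term : Set where
    edge   : Local → Term
    stable : Fin nv → Term

  -- With `outer` equal to `nothing` the surroundings are unknown, so dangling edges weigh nothing
  -- and only inner edges count; `just c` puts the label `c` all around. `mixed` permits labellings
  -- that cut two edges and have both labels on the out-vertices, as when a labelled path crosses
  -- the pole.
  module CutSearch (outer : Maybe Bool) (mixed : Bool) (budget : ℕ) where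

    partial : Vec (Maybe Bool) nv → Place → Maybe Bool
    partial ρ (before _) = outer
    partial ρ (after _)  = outer
    partial ρ (inside v) = lookup ρ v

    differ : Maybe Bool → Maybe Bool → Bool
    differ (just a) (just b) = a xor b
    differ _        _        = false

    partialCut : Vec (Maybe Bool) nv → Local → Bool
    partialCut ρ e = differ (partial ρ (local-tail e)) (partial ρ (local-head e))

    -- A vertex with two known cut edges cannot occur in a stable labelling; charging the whole
    -- budget closes the branch. For a stable labelling the term is free.
    weight : Vec (Maybe Bool) nv → Term → ℕ
    weight ρ (edge e)   = bit (partialCut ρ e)
    weight ρ (stable v) = if 2 ≤ᵇ ℕΣ.sum (bit ∘ partialCut ρ ∘ star v) then budget else 0

    Settled : Vec (Maybe Bool) nv → ℕ → Set
    Settled ρ k = (∀ v → lookup ρ v ≡ just true) ⊎ (∀ v → lookup ρ v ≡ just false)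
      ⊎ (T mixed × 2 ≤ k × Σ (Fin 3) λ p → Σ (Fin 3) λ q →
           lookup ρ (outp p) ≡ just true × lookup ρ (outp q) ≡ just false)

    settled? : ∀ ρ k → Dec (Settled ρ k)
    settled? ρ k = (all? λ v → lookup ρ v ≟ᵐ just true) ⊎-dec (all? λ v → lookup ρ v ≟ᵐ just false)
      ⊎-dec (T? mixed ×-dec (2 ≤? k) ×-dec any? λ p → any? λ q →
           (lookup ρ (outp p) ≟ᵐ just true) ×-dec (lookup ρ (outp q) ≟ᵐ just false))
      where _≟ᵐ_ = Maybe-≡-dec _≟ᵇ_

    open Search {D = Bool} {Term} {nv} (false ∷ true ∷ []) weight budget (λ ρ k → ⌊ settled? ρ k ⌋) public

    -- For a dangling edge both are its vertex in the pole, so `program` meets each local edge once,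
    -- right after branching on its `finish`. The poles list inner edges with the smaller end first,
    -- hence the label of `start` is known by then.
    start finish : Local → Fin nv
    start  = [ [ inp , proj₁ ∘ ends ]′ ∘ splitAt 3 , outp ]′ ∘ splitAt (3 + ni)
    finish = [ [ inp , proj₂ ∘ ends ]′ ∘ splitAt 3 , outp ]′ ∘ splitAt (3 + ni)

    program : List Instruction
    program = concatMap visit (allFin nv)
      where
      visit : Fin nv → List Instruction
      visit v = branch v ∷ map (weigh ∘ edge) es ++ weigh (stable v) ∷ map (weigh ∘ stable ∘ start) es
        where es = filter (λ e → finish e ≟ v) (allFin ((3 + ni) + 3))

    edges : List Term → List Local
    edges []              = []
    edges (edge e ∷ ts)   = e ∷ edges ts
    edges (stable _ ∷ ts) = edges ts

    record Checked : Set where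
      constructor checked
      field
        no-repetition : True (unique? _≟_ (edges (terms program)))
        no-small-cut  : search program (replicate nv nothing) 0 ≡ true
    open Checked

    module _ (L : Labelling)
      (outside : ∀ {c} → outer ≡ just c → (∀ p → left L p ≡ c) × (∀ p → right L p ≡ c)) where

      private
        partial-value : ∀ {ρ} → Agrees ρ (label L) → ∀ a {b} → partial ρ a ≡ just b → value L a ≡ b
        partial-value agrees (before p) eq = proj₁ (outside eq) p
        partial-value agrees (after p)  eq = proj₂ (outside eq) p
        partial-value agrees (inside v) eq = agrees v eq

      partialCut≤cut : ∀ {ρ} → Agrees ρ (label L) → ∀ e → bit (partialCut ρ e) ≤ bit (cutAt L e)
      partialCut≤cut {ρ} agrees e with partial ρ (local-tail e) in t | partial ρ (local-head e) in h
      ... | nothing | _       = z≤n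
      ... | just a  | nothing = z≤n
      ... | just a  | just b  = ≤-reflexive (cong bit (sym (cong₂ _xor_
              (partial-value agrees (local-tail e) t) (partial-value agrees (local-head e) h))))

      module _ (ok : Checked) (L-stable : LocallyStable L)
        (g : Local → ℕ) (cut≤g : ∀ {ρ} → Agrees ρ (label L) → ∀ e → bit (partialCut ρ e) ≤ g e) where

        private
          cost : Term → ℕ
          cost (edge e)   = g e
          cost (stable _) = 0

          weight≤cost : ∀ {ρ} → Agrees ρ (label L) → ∀ t → weight ρ t ≤ cost t
          weight≤cost agrees (edge e) = cut≤g agrees e
          weight≤cost {ρ} agrees (stable v) with 2 ≤ᵇ ℕΣ.sum (bit ∘ partialCut ρ ∘ star v) in eq
          ... | false = z≤n
          ... | true  = ⊥-elim (≤⇒≯ (L-stable v)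
                  (≤-trans (true-≤ eq) (sum-mono-≤ (λ j → partialCut≤cut {ρ} agrees (star v j)))))

          values-complete : ∀ b → b ∈ false ∷ true ∷ []
          values-complete false = here refl
          values-complete true  = there (here refl)

          total-cost : costs (label L) (values-complete ∘ label L) cost weight≤cost (terms program) ≤ ℕΣ.sum g
          total-cost = ≤-trans (≤-reflexive (only-edges (terms program))) (costs-unique g (toWitness (no-repetition ok)))
            where
            only-edges : ∀ ts → costs (label L) (values-complete ∘ label L) cost weight≤cost ts
                              ≡ foldr (λ e → g e +_) 0 (edges ts)
            only-edges []              = refl
            only-edges (edge e ∷ ts)   = cong (g e +_) (only-edges ts)
            only-edges (stable _ ∷ ts) = only-edges ts

          witness : ∀ {A : Set} (d : Dec A) → ⌊ d ⌋ ≡ true → A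
          witness (yes a) _ = a

        private
          conclude : ∀ {m} → m ≤ ℕΣ.sum g → Outcome (label L) (values-complete ∘ label L) cost weight≤cost m →
            Constant L ⊎ budget ≤ ℕΣ.sum g ⊎ (T mixed × 2 ≤ ℕΣ.sum g × MixedOut L)
          conclude m≤ (inj₁ over) = inj₂ (inj₁ (≤-trans over m≤))
          conclude m≤ (inj₂ (ρ , k , agrees , settled , k≤)) with witness (settled? ρ k) settled
          ... | inj₁ all-true         = inj₁ (true  , λ v → agrees v (all-true v))
          ... | inj₂ (inj₁ all-false) = inj₁ (false , λ v → agrees v (all-false v))
          ... | inj₂ (inj₂ (m , 2≤k , p , q , tp , fq)) = inj₂ (inj₂ (m , ≤-trans 2≤k (≤-trans k≤ m≤) ,
                  λ { (c , eq) → true≢false (trans (sym (agrees _ tp)) (trans (eq p) (trans (sym (eq q)) (agrees _ fq)))) }))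

        cut-outcome : Constant L ⊎ budget ≤ ℕΣ.sum g ⊎ (T mixed × 2 ≤ ℕΣ.sum g × MixedOut L)
        cut-outcome = conclude (≤-trans (≤-reflexive (+-identityʳ _)) total-cost)
          (search-sound (label L) (values-complete ∘ label L) cost weight≤cost
            program (agrees-nothing {label L}) (no-small-cut ok))

  module _ (mixed : Bool) where
    open CutSearch nothing mixed 3

    -- With unknown surroundings a dangling edge never has two known ends, so it may be charged
    -- nothing and the bound concerns inner edges alone.
    inner-outcome : Checked → (L : Labelling) → LocallyStable L →
      Constant L ⊎ 3 ≤ innerCut L ⊎ (T mixed × 2 ≤ innerCut L × MixedOut L)
    inner-outcome ok L L-stable = subst (λ m → Constant L ⊎ 3 ≤ m ⊎ (T mixed × 2 ≤ m × MixedOut L)) sum-inner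
      (cut-outcome L (λ ()) ok L-stable inner dangling-free)
      where
      innerOwn : Own → ℕ
      innerOwn = [ (λ _ → 0) , (λ k → bit (label L (proj₁ (ends k)) xor label L (proj₂ (ends k)))) ]′ ∘ splitAt 3
      inner : Local → ℕ
      inner = [ innerOwn , (λ _ → 0) ]′ ∘ splitAt (3 + ni)
      sum-inner : ℕΣ.sum inner ≡ innerCut L
      sum-inner = trans (ℕΣ.sum-split (3 + ni) inner) (trans (cong₂ _+_ owns outs) (+-identityʳ (ℕΣ.sum innerOwn)))
        where
        owns : ℕΣ.sum {3 + ni} (λ i → inner (i ↑ˡ 3)) ≡ ℕΣ.sum innerOwn
        owns = ℕΣ.sum-cong-≗ {3 + ni} {λ i → inner (i ↑ˡ 3)} {innerOwn} (λ i → cong [ innerOwn , (λ _ → 0) ]′ (splitAt-↑ˡ (3 + ni) i 3))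
        outs : ℕΣ.sum {3} (λ p → inner ((3 + ni) ↑ʳ p)) ≡ 0
        outs = ℕΣ.sum-ε {3} {λ p → inner ((3 + ni) ↑ʳ p)} (λ p → cong [ innerOwn , (λ _ → 0) ]′ (splitAt-↑ʳ (3 + ni) 3 p))
      dangling-free : ∀ {ρ} → Agrees ρ (label L) → ∀ e → bit (partialCut ρ e) ≤ inner e
      dangling-free {ρ} agrees = go
        where
        go : ∀ e → bit (partialCut ρ e) ≤ inner e
        go e with splitAt (3 + ni) e
        ... | inj₂ p with lookup ρ (outp p)
        ...   | nothing = z≤n
        ...   | just _  = z≤n
        go e | inj₁ o with splitAt 3 o
        ...   | inj₁ p = z≤n
        ...   | inj₂ k with lookup ρ (proj₁ (ends k)) in t | lookup ρ (proj₂ (ends k)) in h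
        ...     | nothing | _       = z≤n
        ...     | just a  | nothing = z≤n
        ...     | just a  | just b  = ≤-reflexive (cong bit (sym (cong₂ _xor_ (agrees _ t) (agrees _ h))))

  module _ (c : Bool) where
    open CutSearch (just c) false 5

    full-outcome : Checked → (L : Labelling) → LocallyStable L →
      (∀ p → left L p ≡ c) → (∀ p → right L p ≡ c) → Constant L ⊎ 5 ≤ fullCut L
    full-outcome ok L L-stable onLeft onRight =
      conclude (cut-outcome L outside ok L-stable (bit ∘ cutAt L) (partialCut≤cut L outside))
      where
      outside : ∀ {d} → just c ≡ just d → (∀ p → left L p ≡ d) × (∀ p → right L p ≡ d)
      outside refl = onLeft , onRight
      conclude : ∀ {A B C : Set} → A ⊎ B ⊎ (⊥ × C) → A ⊎ B
      conclude (inj₁ a)        = inj₁ a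
      conclude (inj₂ (inj₁ b)) = inj₂ b

-- Refuting nowhere-zero flows on a pole

hues : List Z2²
hues = colour zero ∷ colour (suc zero) ∷ colour (suc (suc zero)) ∷ []

hues-complete : ∀ x → x ≢ zero² → x ∈ hues
hues-complete (false , false) x≢0 = ⊥-elim (x≢0 refl)
hues-complete (false , true)  _   = here refl
hues-complete (true  , false) _   = there (here refl)
hues-complete (true  , true)  _   = there (there (here refl))

-- Equal values cancel in characteristic two. The search can therefore test for distinctness at a
-- vertex in place of Kirchhoff's law.
repeated-left : ∀ {a b c} → (a ⊕ (b ⊕ (c ⊕ zero²))) ≡ zero² → a ≡ b → c ≡ zero²
repeated-left {a} {_} {c} eq refl = trans (sym (⊕-identityʳ c)) (trans (cong (_⊕ (c ⊕ zero²)) (sym (⊕-self a)))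
  (trans (⊕-assoc a a (c ⊕ zero²)) eq))

repeated-right : ∀ {a b c} → (a ⊕ (b ⊕ (c ⊕ zero²))) ≡ zero² → b ≡ c → a ≡ zero²
repeated-right {a} {b} {_} eq refl = trans (sym (⊕-identityʳ a)) (trans (cong (a ⊕_)
  (sym (trans (cong (b ⊕_) (⊕-identityʳ b)) (⊕-self b)))) eq)

repeated-outer : ∀ {a b c} → (a ⊕ (b ⊕ (c ⊕ zero²))) ≡ zero² → a ≡ c → b ≡ zero²
repeated-outer {a} {b} {c} eq = repeated-left {a} {c} {b} (trans (cong (a ⊕_) (swap c b)) eq)
  where
  swap : ∀ c b → (c ⊕ (b ⊕ zero²)) ≡ (b ⊕ (c ⊕ zero²))
  swap c b = trans (cong (c ⊕_) (⊕-identityʳ b)) (trans (⊕-comm c b) (cong (b ⊕_) (sym (⊕-identityʳ c))))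

-- `excluded` marks the connector sums that a refutation leaves aside. Every violation weighs 1,
-- which is the whole budget, and no leaf is accepted; so success of the search means that all
-- branches are contradictory.
module FlowSearch (P : Pole) (excluded : Z2² → Bool) where
  open Pole P

  data FlowTerm : Set where
    distinct : Fin nv → FlowTerm
    in-sum   : FlowTerm

  known : Vec (Maybe Z2²) (3 + ni) → Own ⊎ Fin 3 → Maybe Z2²
  known ρ (inj₁ o) = lookup ρ o
  known ρ (inj₂ _) = nothing

  equal : Maybe Z2² → Maybe Z2² → Bool
  equal (just x) (just y) = ⌊ x ≟² y ⌋
  equal _        _        = false

  isOwn : Own ⊎ Fin 3 → Bool
  isOwn (inj₁ _) = true
  isOwn (inj₂ _) = false

  -- Two equal values force a zero on the third edge, which is a contradiction only if this pole
  -- owns that edge. Out-edges may vanish: their zeros are counted with the next pole.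
  clash : Vec (Maybe Z2²) (3 + ni) → (a b c : Own ⊎ Fin 3) → Bool
  clash ρ a b c = (isOwn c ∧ equal (known ρ a) (known ρ b))
                ∨ (isOwn b ∧ equal (known ρ a) (known ρ c))
                ∨ (isOwn a ∧ equal (known ρ b) (known ρ c))

  excludes : Maybe Z2² → Maybe Z2² → Maybe Z2² → Bool
  excludes (just a) (just b) (just c) = excluded (a ⊕ (b ⊕ (c ⊕ zero²)))
  excludes _        _        _        = false

  weight : Vec (Maybe Z2²) (3 + ni) → FlowTerm → ℕ
  weight ρ (distinct v) = bit (clash ρ (slot zero) (slot (suc zero)) (slot (suc (suc zero))))
    where
    slot : Fin 3 → Own ⊎ Fin 3
    slot j = splitAt (3 + ni) (star v j)
  weight ρ in-sum = bit (excludes (lookup ρ zero) (lookup ρ (suc zero)) (lookup ρ (suc (suc zero))))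

  open Search {D = Z2²} {FlowTerm} {3 + ni} hues weight 1 (λ _ _ → false) public

  program : List Own → List Instruction
  program = concatMap λ o → branch o ∷ weigh in-sum ∷ vertex (own-tail o) ++ vertex (own-head o)
    where
    vertex : Place → List Instruction
    vertex (inside v) = weigh (distinct v) ∷ []
    vertex _          = []

  record Refuted : Set where
    constructor refuted
    field
      order : List Own
      fails : search (program order) (replicate (3 + ni) nothing) 0 ≡ true

  module _ (f : Local → Z2²) (balanced : ∀ v → ZΣ.sum (f ∘ star v) ≡ zero²)
    (nonzero : (o : Own) → f (o ↑ˡ 3) ≢ zero²)
    (allowed : excluded (ZΣ.sum {3} λ p → f ((p ↑ˡ ni) ↑ˡ 3)) ≡ false) where

    private
      x : Own → Z2²
      x o = f (o ↑ˡ 3)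

      f-own : ∀ e {o} → splitAt (3 + ni) e ≡ inj₁ o → x o ≡ f e
      f-own e eq = cong f (splitAt⁻¹-↑ˡ eq)

      equal-sound : ∀ {ρ} → Agrees ρ x → ∀ e e' →
        equal (known ρ (splitAt (3 + ni) e)) (known ρ (splitAt (3 + ni) e')) ≡ true → f e ≡ f e'
      equal-sound {ρ} agrees e e' eq with splitAt (3 + ni) e in s | splitAt (3 + ni) e' in s'
      ... | inj₁ o | inj₁ o' with lookup ρ o in l | lookup ρ o' in l'
      ...   | just a | just b with a ≟² b
      ...     | yes refl = trans (sym (f-own e s)) (trans (agrees o l) (trans (sym (agrees o' l')) (f-own e' s')))
      equal-sound {ρ} agrees e e' () | inj₁ o | inj₁ o' | just a | just b | no _
      equal-sound {ρ} agrees e e' () | inj₁ o | inj₁ o' | just a | nothing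
      equal-sound {ρ} agrees e e' () | inj₁ o | inj₁ o' | nothing | _
      equal-sound {ρ} agrees e e' eq | inj₁ o | inj₂ _ with lookup ρ o
      equal-sound {ρ} agrees e e' () | inj₁ o | inj₂ _ | just _
      equal-sound {ρ} agrees e e' () | inj₁ o | inj₂ _ | nothing
      equal-sound {ρ} agrees e e' () | inj₂ _ | _

      isOwn-nonzero : ∀ e → isOwn (splitAt (3 + ni) e) ≡ true → f e ≢ zero²
      isOwn-nonzero e eq with splitAt (3 + ni) e in s
      ... | inj₁ o = nonzero o ∘ trans (f-own e s)

      ∨-true : ∀ {a b} → a ∨ b ≡ true → a ≡ true ⊎ b ≡ true
      ∨-true {true}  _  = inj₁ refl
      ∨-true {false} eq = inj₂ eq

      no-clash : ∀ {ρ} → Agrees ρ x → ∀ v → weight ρ (distinct v) ≡ 0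
      no-clash {ρ} agrees v with clash ρ (splitAt (3 + ni) (star v zero)) (splitAt (3 + ni) (star v (suc zero)))
        (splitAt (3 + ni) (star v (suc (suc zero)))) in eq
      ... | false = refl
      ... | true with ∨-true eq
      ...   | inj₁ h = ⊥-elim (isOwn-nonzero _ (proj₁ (∧-true h)) (repeated-left (balanced v)
                        (equal-sound {ρ} agrees _ _ (proj₂ (∧-true {isOwn (splitAt (3 + ni) (star v (suc (suc zero))))} h)))))
      ...   | inj₂ h with ∨-true h
      ...     | inj₁ h′ = ⊥-elim (isOwn-nonzero _ (proj₁ (∧-true h′)) (repeated-outer (balanced v)
                        (equal-sound {ρ} agrees _ _ (proj₂ (∧-true {isOwn (splitAt (3 + ni) (star v (suc zero)))} h′)))))
      ...     | inj₂ h′ = ⊥-elim (isOwn-nonzero _ (proj₁ (∧-true h′)) (repeated-right (balanced v)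
                        (equal-sound {ρ} agrees _ _ (proj₂ (∧-true {isOwn (splitAt (3 + ni) (star v zero))} h′)))))

      not-excluded : ∀ {ρ} → Agrees ρ x → weight ρ in-sum ≡ 0
      not-excluded {ρ} agrees with lookup ρ zero in l₀ | lookup ρ (suc zero) in l₁ | lookup ρ (suc (suc zero)) in l₂
      ... | nothing | _       | _       = refl
      ... | just a  | nothing | _       = refl
      ... | just a  | just b  | nothing = refl
      ... | just a  | just b  | just c  = cong bit (trans (cong excluded (sym
              (cong₂ _⊕_ (agrees _ l₀) (cong₂ _⊕_ (agrees _ l₁) (cong (_⊕ zero²) (agrees _ l₂)))))) allowed)

      weight≤0 : ∀ {ρ} → Agrees ρ x → ∀ t → weight ρ t ≤ 0
      weight≤0 {ρ} agrees (distinct v) = ≤-reflexive (no-clash {ρ} agrees v)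
      weight≤0 {ρ} agrees in-sum       = ≤-reflexive (not-excluded {ρ} agrees)

      no-cost : ∀ ts → costs x (λ o → hues-complete (x o) (nonzero o)) (λ _ → 0) weight≤0 ts ≡ 0
      no-cost []       = refl
      no-cost (t ∷ ts) = no-cost ts

      conclude : ∀ {m} → m ≡ 0 → ¬ Outcome x (λ o → hues-complete (x o) (nonzero o)) (λ _ → 0) weight≤0 m
      conclude refl (inj₁ ())
      conclude refl (inj₂ (_ , _ , _ , () , _))

    no-nonzero-flow : ¬ Refuted
    no-nonzero-flow (refuted order fails) =
      conclude (trans (+-identityʳ _) (no-cost (terms (program order))))
        (search-sound x (λ o → hues-complete (x o) (nonzero o)) (λ _ → 0) weight≤0 (program order)
          (agrees-nothing {x}) fails)

enc-injective : ∀ {m} (sz : Fin m → ℕ) i x j y → enc sz i x ≡ enc sz j y →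
  _≡_ {A = Σ (Fin m) (Fin ∘ sz)} (i , x) (j , y)
enc-injective sz i x j y eq = trans (sym (dec-enc sz i x)) (trans (cong (dec sz) eq) (dec-enc sz j y))

-- Rings of poles

prev : ∀ {m} → Fin (suc m) → Fin (suc m)
prev zero    = fromℕ _
prev (suc i) = inject₁ i

next-view : ∀ {m} {i : Fin (suc m)} → View i → Fin (suc m)
next-view ‵fromℕ       = zero
next-view (‵inject₁ j) = suc j

next : ∀ {m} → Fin (suc m) → Fin (suc m)
next i = next-view (view i)

prev-next : ∀ {m} (i : Fin (suc m)) → prev (next i) ≡ i
prev-next i = go (view i)
  where
  go : ∀ {m} {i : Fin (suc m)} (v : View i) → prev (next-view v) ≡ i
  go ‵fromℕ       = refl
  go (‵inject₁ j) = refl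

next-prev : ∀ {m} (i : Fin (suc m)) → next (prev i) ≡ i
next-prev {m} zero   = cong next-view (view-fromℕ m)
next-prev    (suc i) = cong next-view (view-inject₁ i)

prev≢ : ∀ {m} → m ≢ 0 → (i : Fin (suc m)) → prev i ≢ i
prev≢ {zero}  m≢0 zero    eq = m≢0 refl
prev≢ {suc m} m≢0 zero    ()
prev≢         m≢0 (suc i) eq = 1+n≢n (sym (trans (sym (toℕ-inject₁ i)) (cong toℕ eq)))

-- Climb from `i` to the last index, step over to zero, and climb once more through all indices.
cyclic-induction : ∀ {m} (Q : Fin (suc m) → Set) → (∀ k → Q (prev k) → Q k) → ∀ i → Q i → ∀ j → Q j
cyclic-induction {m} Q ascend i Qi =
  <-weakInduction Q (ascend zero (<-weakInduction-startingFrom Q Qi (λ j → ascend (suc j)) (≤fromℕ i))) (λ j → ascend (suc j))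

-- If two poles are non-constant they carry all four cut edges, so the next pole is non-constant
-- as well, and this propagates to the strict pole.  If there is one, it is surrounded by a constant.
module FewCutEdges {m : ℕ} (m≢0 : m ≢ 0) (inCut inner : Fin (suc m) → ℕ)
  (Const : Fin (suc m) → Bool → Set) (MixedOut : Fin (suc m) → Set)
  (strict : Fin (suc m))
  (outcome : ∀ i → Σ Bool (Const i) ⊎ 3 ≤ inner i ⊎ (i ≢ strict × 2 ≤ inner i × MixedOut i))
  (inner-const : ∀ i {c} → Const i c → inner i ≡ 0)
  (step-const : ∀ k {c c'} → Const (prev k) c → Const k c' → c ≡ c' ⊎ 3 ≤ inCut k)
  (step-mixed : ∀ k {c} → MixedOut (prev k) → Const k c → 1 ≤ inCut k)
  (surrounded : ∀ i {c} → Const (prev i) c → Const (next i) c →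
    Σ Bool (Const i) ⊎ 5 ≤ (inCut i + inner i) + inCut (next i))
  (not-all-const : ∀ c → ¬ (∀ i → Const i c))
  (few : ¬ (5 ≤ ℕΣ.sum inCut + ℕΣ.sum inner)) where

  private
    smooth : ∀ i → ¬ (2 ≤ inner i) → Σ Bool (Const i)
    smooth i 2≰ with outcome i
    ... | inj₁ constant            = constant
    ... | inj₂ (inj₁ 3≤)           = ⊥-elim (2≰ (≤-trans (s≤s (s≤s z≤n)) 3≤))
    ... | inj₂ (inj₂ (_ , 2≤ , _)) = ⊥-elim (2≰ 2≤)

    rough-not-const : ∀ i {c} → 2 ≤ inner i → ¬ Const i c
    rough-not-const i 2≤ const-c with () ← subst (2 ≤_) (inner-const i const-c) 2≤

    two-rough : ∀ i j → i ≢ j → 2 ≤ inner i → 2 ≤ inner j → ⊥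
    two-rough i j i≢j 2≤i 2≤j =
      proj₁ (mixed-out strict (cyclic-induction (λ k → 2 ≤ inner k) ascend i 2≤i strict)) refl
      where
      uncut : ∀ k → ¬ (1 ≤ inCut k)
      uncut k 1≤ = few (+-mono-≤ (≤-trans 1≤ (term≤sum inCut k)) (≤-trans (+-mono-≤ 2≤i 2≤j) (terms≤sum inner i≢j)))
      other : ∀ k → Σ (Fin (suc m)) λ l → k ≢ l × 2 ≤ inner l
      other k with k ≟ i
      ... | no k≢i   = i , k≢i , 2≤i
      ... | yes refl = j , i≢j , 2≤j
      mixed-out : ∀ k → 2 ≤ inner k → k ≢ strict × MixedOut k
      mixed-out k 2≤k with outcome k | other k
      ... | inj₁ (_ , constant)      | _ = ⊥-elim (rough-not-const k 2≤k constant)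
      ... | inj₂ (inj₂ (k≢ , _ , o)) | _ = k≢ , o
      ... | inj₂ (inj₁ 3≤k)          | l , k≢l , 2≤l = ⊥-elim (few (≤-trans
              (≤-trans (+-mono-≤ 3≤k 2≤l) (terms≤sum inner k≢l)) (m≤n+m (ℕΣ.sum inner) (ℕΣ.sum inCut))))
      ascend : ∀ k → 2 ≤ inner (prev k) → 2 ≤ inner k
      ascend k 2≤ with 2 ≤? inner k
      ... | yes 2≤k = 2≤k
      ... | no 2≰k  = ⊥-elim (uncut k (step-mixed k (proj₂ (mixed-out (prev k) 2≤)) (proj₂ (smooth k 2≰k))))

    -- The constant can change only at a connector with three cut edges, and `3 + 2` is already
    -- five. Hence it stays the same all the way from `next i` around to `prev i`, and `surrounded`
    -- applies to `i`.
    one-rough : ∀ i → 2 ≤ inner i → (∀ j → j ≢ i → Σ Bool (Const j)) → ⊥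
    one-rough i 2≤i others = conclude (surrounded i (const-c (prev i) (prev≢ m≢0 i)) (const-c (next i) next≢))
      where
      next≢ : next i ≢ i
      next≢ eq = prev≢ m≢0 (next i) (trans (prev-next i) (sym eq))
      c : Bool
      c = proj₁ (others (next i) next≢)
      -- The alternative `k ≡ i` lets the induction pass over the rough pole; directly behind it the
      -- constant is `c` by choice.
      ascend : ∀ k → prev k ≡ i ⊎ Const (prev k) c → k ≡ i ⊎ Const k c
      ascend k (inj₁ eq) = inj₂ (subst (λ k → Const k c) (trans (cong next (sym eq)) (next-prev k)) (proj₂ (others (next i) next≢)))
      ascend k (inj₂ const-prev) with k ≟ i
      ... | yes k≡i = inj₁ k≡i
      ... | no k≢i with step-const k const-prev (proj₂ (others k k≢i))
      ...   | inj₁ eq = inj₂ (subst (Const k) (sym eq) (proj₂ (others k k≢i)))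
      ...   | inj₂ 3≤ = ⊥-elim (few (+-mono-≤ (≤-trans 3≤ (term≤sum inCut k)) (≤-trans 2≤i (term≤sum inner i))))
      const-c : ∀ j → j ≢ i → Const j c
      const-c j j≢i with cyclic-induction (λ j → j ≡ i ⊎ Const j c) ascend i (inj₁ refl) j
      ... | inj₁ j≡i     = ⊥-elim (j≢i j≡i)
      ... | inj₂ const-j = const-j
      rearrange : ∀ a b c → (a + b) + c ≡ (a + c) + b
      rearrange a b c = trans (+-assoc a b c) (trans (cong (a +_) (+-comm b c)) (sym (+-assoc a c b)))
      conclude : Σ Bool (Const i) ⊎ 5 ≤ (inCut i + inner i) + inCut (next i) → ⊥
      conclude (inj₁ (_ , const-i)) = rough-not-const i 2≤i const-i
      conclude (inj₂ 5≤) = few (≤-trans 5≤ (≤-trans (≤-reflexive (rearrange (inCut i) (inner i) (inCut (next i))))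
        (+-mono-≤ (terms≤sum inCut (next≢ ∘ sym)) (term≤sum inner i))))

    -- At most one connector k is cut, so following the ring from k on the constant never changes.
    none-rough : (∀ i → Σ Bool (Const i)) → ⊥
    none-rough const = not-all-const c (cyclic-induction (λ l → Const l c) ascend k (proj₂ (const k)))
      where
      breaking : Σ (Fin (suc m)) λ k → ∀ l → l ≢ k → ¬ (3 ≤ inCut l)
      breaking with any? (λ k → 3 ≤? inCut k)
      ... | no none       = zero , λ l _ 3≤ → none (l , 3≤)
      ... | yes (k , 3≤k) = k , λ l l≢k 3≤ → few (≤-trans (≤-trans (s≤s (s≤s (s≤s (s≤s (s≤s z≤n)))))
              (≤-trans (+-mono-≤ 3≤ 3≤k) (terms≤sum inCut l≢k))) (m≤m+n (ℕΣ.sum inCut) (ℕΣ.sum inner)))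
      k : Fin (suc m)
      k = proj₁ breaking
      c : Bool
      c = proj₁ (const k)
      ascend : ∀ l → Const (prev l) c → Const l c
      ascend l const-prev with l ≟ k
      ... | yes eq = subst (λ l → Const l c) (sym eq) (proj₂ (const k))
      ... | no l≢k with step-const l const-prev (proj₂ (const l))
      ...   | inj₁ eq = subst (Const l) (sym eq) (proj₂ (const l))
      ...   | inj₂ 3≤ = ⊥-elim (proj₂ breaking l l≢k 3≤)

  impossible : ⊥
  impossible with any? (λ i → 2 ≤? inner i)
  ... | no none = none-rough (λ i → smooth i (λ 2≤ → none (i , 2≤)))
  ... | yes (i , 2≤i) with any? (λ j → ¬? (i ≟ j) ×-dec (2 ≤? inner j))
  ...   | yes (j , i≢j , 2≤j) = two-rough i j i≢j 2≤i 2≤j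
  ...   | no none = one-rough i 2≤i (λ j j≢i → smooth j (λ 2≤ → none (j , j≢i ∘ sym , 2≤)))

module Ring {m : ℕ} (m≢0 : m ≢ 0) (P : Fin (suc m) → Pole) (wf : ∀ i → PoleTheory.WellFormed (P i)) where

  open module At (i : Fin (suc m)) = Pole (P i) using (nv; ni; ends; inp; outp; star; Own; Local; own-tail; own-head; local-tail; local-head)
  open Pole using (before; after; inside)

  private
    module W (i : Fin (suc m)) where
      open PoleTheory (P i) public
      loopless′ = proj₁ (wf i)
      simple    = proj₁ (proj₂ (wf i))
      disjoint  = proj₁ (proj₂ (proj₂ (wf i)))
      outp-inj  = proj₁ (proj₂ (proj₂ (proj₂ (wf i))))
      star-inj  = proj₁ (proj₂ (proj₂ (proj₂ (proj₂ (wf i)))))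
      touching  = proj₁ (proj₂ (proj₂ (proj₂ (proj₂ (proj₂ (wf i))))))
      listed    = proj₂ (proj₂ (proj₂ (proj₂ (proj₂ (proj₂ (wf i))))))

  nOwn : Fin (suc m) → ℕ
  nOwn i = 3 + ni i

  nV′ nE′ : ℕ
  nV′ = total nv
  nE′ = total nOwn

  vertex : ∀ i → Fin (nv i) → Fin nV′
  vertex = enc nv

  own : ∀ i → Own i → Fin nE′
  own = enc nOwn

  inEdge : ∀ i → Fin 3 → Fin nE′
  inEdge i p = own i (p ↑ˡ ni i)

  place : ∀ i → Pole.Place (P i) → Fin nV′
  place i (before p) = vertex (prev i) (outp (prev i) p)
  place i (after p)  = vertex (next i) (inp (next i) p)
  place i (inside x) = vertex i x

  src′ tgt′ : Fin nE′ → Fin nV′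
  src′ e = let (i , o) = dec nOwn e in place i (own-tail i o)
  tgt′ e = let (i , o) = dec nOwn e in place i (own-head i o)

  src-own : ∀ i o → src′ (own i o) ≡ place i (own-tail i o)
  src-own i o = cong (λ (i , o) → place i (own-tail i o)) (dec-enc nOwn i o)

  tgt-own : ∀ i o → tgt′ (own i o) ≡ place i (own-head i o)
  tgt-own i o = cong (λ (i , o) → place i (own-head i o)) (dec-enc nOwn i o)

  same-pole : ∀ i x j y → vertex i x ≡ vertex j y → i ≡ j
  same-pole i x j y eq = cong proj₁ (enc-injective nv i x j y eq)

  same-vertex : ∀ i x y → vertex i x ≡ vertex i y → x ≡ y
  same-vertex i x y eq with refl ← enc-injective nv i x i y eq = refl

  same-own : ∀ i o o' → own i o ≡ own i o' → o ≡ o'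
  same-own i o o' eq with refl ← enc-injective nOwn i o i o' eq = refl

  loopless-own : ∀ i o → place i (own-tail i o) ≢ place i (own-head i o)
  loopless-own i o eq with splitAt 3 o
  ... | inj₁ p = prev≢ m≢0 i (same-pole (prev i) _ i _ eq)
  ... | inj₂ k = W.loopless′ i k (same-vertex i _ _ eq)

  -- Parallel edges would lie in one pole or join the same two poles in opposite directions.
  noParallel-own : ∀ i o j o' →
    (place i (own-tail i o) ≡ place j (own-tail j o') × place i (own-head i o) ≡ place j (own-head j o'))
    ⊎ (place i (own-tail i o) ≡ place j (own-head j o') × place i (own-head i o) ≡ place j (own-tail j o'))
    → own i o ≡ own j o'
  noParallel-own i o j o' same with splitAt 3 o in eq | splitAt 3 o' in eq'
  noParallel-own i o j o' (inj₁ (t , h)) | inj₁ p | inj₁ q with refl ← same-pole i _ j _ h =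
    cong (own i) (trans (sym (splitAt⁻¹-↑ˡ eq)) (trans (cong (_↑ˡ ni i)
      (W.outp-inj (prev i) p q (same-vertex (prev i) _ _ t))) (splitAt⁻¹-↑ˡ eq')))
  noParallel-own i o j o' (inj₂ (t , h)) | inj₁ p | inj₁ q with refl ← same-pole (prev i) _ j _ t =
    ⊥-elim (W.disjoint (prev i) q p (sym (same-vertex (prev i) _ _ t)))
  noParallel-own i o j o' (inj₁ (t , h)) | inj₁ p | inj₂ k =
    ⊥-elim (prev≢ m≢0 i (trans (same-pole (prev i) _ j _ t) (sym (same-pole i _ j _ h))))
  noParallel-own i o j o' (inj₂ (t , h)) | inj₁ p | inj₂ k =
    ⊥-elim (prev≢ m≢0 i (trans (same-pole (prev i) _ j _ t) (sym (same-pole i _ j _ h))))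
  noParallel-own i o j o' (inj₁ (t , h)) | inj₂ k | inj₁ q =
    ⊥-elim (prev≢ m≢0 j (trans (sym (same-pole i _ (prev j) _ t)) (same-pole i _ j _ h)))
  noParallel-own i o j o' (inj₂ (t , h)) | inj₂ k | inj₁ q =
    ⊥-elim (prev≢ m≢0 j (trans (sym (same-pole i _ (prev j) _ h)) (same-pole i _ j _ t)))
  noParallel-own i o j o' (inj₁ (t , h)) | inj₂ k | inj₂ l with refl ← same-pole i _ j _ t =
    cong (own i) (trans (sym (splitAt⁻¹-↑ʳ eq)) (trans (cong (3 ↑ʳ_)
      (W.simple i k l (inj₁ (same-vertex i _ _ t , same-vertex i _ _ h)))) (splitAt⁻¹-↑ʳ eq')))
  noParallel-own i o j o' (inj₂ (t , h)) | inj₂ k | inj₂ l with refl ← same-pole i _ j _ t =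
    cong (own i) (trans (sym (splitAt⁻¹-↑ʳ eq)) (trans (cong (3 ↑ʳ_)
      (W.simple i k l (inj₂ (same-vertex i _ _ t , same-vertex i _ _ h)))) (splitAt⁻¹-↑ʳ eq')))

  H : Graph
  H = record
    { nV = nV′ ; nE = nE′ ; src = src′ ; tgt = tgt′
    ; loopless   = λ e → loopless′ (decode nOwn e)
    ; noParallel = λ e e' → noParallel′ (decode nOwn e) (decode nOwn e')
    }
    where
    loopless′ : ∀ {e} → Encoded nOwn e → src′ e ≢ tgt′ e
    loopless′ (at i o) eq = loopless-own i o (trans (sym (src-own i o)) (trans eq (tgt-own i o)))
    noParallel′ : ∀ {e e'} → Encoded nOwn e → Encoded nOwn e' →
      (src′ e ≡ src′ e' × tgt′ e ≡ tgt′ e') ⊎ (src′ e ≡ tgt′ e' × tgt′ e ≡ src′ e') → e ≡ e'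
    noParallel′ (at i o) (at j o') same rewrite src-own i o | tgt-own i o | src-own j o' | tgt-own j o' =
      noParallel-own i o j o' same

  global : ∀ i → Local i → Fin nE′
  global i = [ own i , inEdge (next i) ]′ ∘ splitAt (3 + ni i)

  src-global : ∀ i e → src′ (global i e) ≡ place i (local-tail i e)
  src-global i e with splitAt (3 + ni i) e
  ... | inj₁ o = src-own i o
  ... | inj₂ p = trans (src-own (next i) (p ↑ˡ _))
    (trans (cong (place (next i) ∘ [ before , _ ]′) (splitAt-↑ˡ 3 p (ni (next i))))
           (cong (λ k → vertex k (outp k p)) (prev-next i)))

  tgt-global : ∀ i e → tgt′ (global i e) ≡ place i (local-head i e)
  tgt-global i e with splitAt (3 + ni i) e
  ... | inj₁ o = tgt-own i o
  ... | inj₂ p = trans (tgt-own (next i) (p ↑ˡ _))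
    (cong (place (next i) ∘ [ inside ∘ inp (next i) , _ ]′) (splitAt-↑ˡ 3 p (ni (next i))))

  global-injective : ∀ i e e' → global i e ≡ global i e' → e ≡ e'
  global-injective i e e' eq with splitAt (3 + ni i) e in s | splitAt (3 + ni i) e' in s'
  ... | inj₁ o | inj₁ o' = trans (sym (splitAt⁻¹-↑ˡ s)) (trans (cong (_↑ˡ 3) (same-own i o o' eq)) (splitAt⁻¹-↑ˡ s'))
  ... | inj₂ p | inj₂ q  = trans (sym (splitAt⁻¹-↑ʳ s)) (trans (cong ((3 + ni i) ↑ʳ_)
                             (↑ˡ-injective _ p q (same-own (next i) _ _ eq))) (splitAt⁻¹-↑ʳ s'))
  ... | inj₁ o | inj₂ q  = ⊥-elim (prev≢ m≢0 (next i) (trans (prev-next i)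
                             (cong proj₁ (enc-injective nOwn i _ (next i) _ eq))))
  ... | inj₂ p | inj₁ o  = ⊥-elim (prev≢ m≢0 (next i) (trans (prev-next i)
                             (cong proj₁ (enc-injective nOwn i _ (next i) _ (sym eq)))))

  inc′ : Fin nV′ → Fin 3 → Fin nE′
  inc′ v j = let (i , x) = dec nv v in global i (star i x j)

  inc-vertex : ∀ i x j → inc′ (vertex i x) j ≡ global i (star i x j)
  inc-vertex i x j = cong (λ (i , x) → global i (star i x j)) (dec-enc nv i x)

  -- An in-edge starts outside its owner. There it is an out-edge of the previous pole, whose
  -- well-formedness provides the slot.
  own-listed : ∀ i o a → own-tail i o ≡ a ⊎ own-head i o ≡ a → ∀ k x → place i a ≡ vertex k x →
    Σ (Fin 3) λ j → inc′ (vertex k x) j ≡ own i o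
  own-listed i o (after p) eq k x at-a = ⊥-elim (no-after eq)
    where
    no-after : ¬ (own-tail i o ≡ after p ⊎ own-head i o ≡ after p)
    no-after eq with splitAt 3 o
    no-after (inj₁ ()) | inj₁ _
    no-after (inj₂ ()) | inj₁ _
    no-after (inj₁ ()) | inj₂ _
    no-after (inj₂ ()) | inj₂ _
  own-listed i o (inside y) eq k x at-a with refl ← enc-injective nv i y k x at-a =
    let (j , star≡) = find eq in j , trans (inc-vertex i y j) (trans (cong (global i) star≡) own≡)
    where
    own≡ : global i (o ↑ˡ 3) ≡ own i o
    own≡ = cong [ own i , _ ]′ (splitAt-↑ˡ (3 + ni i) o 3)
    find : own-tail i o ≡ inside y ⊎ own-head i o ≡ inside y → Σ (Fin 3) λ j → star i y j ≡ o ↑ˡ 3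
    find (inj₁ t) = subst (W.Listed i (o ↑ˡ 3)) (trans (cong [ own-tail i , _ ]′ (splitAt-↑ˡ (3 + ni i) o 3)) t)
                      (proj₁ (W.listed i (o ↑ˡ 3)))
    find (inj₂ h) = subst (W.Listed i (o ↑ˡ 3)) (trans (cong [ own-head i , _ ]′ (splitAt-↑ˡ (3 + ni i) o 3)) h)
                      (proj₂ (W.listed i (o ↑ˡ 3)))
  own-listed i o (before p) eq k x at-a with refl ← enc-injective nv (prev i) _ k x at-a =
    let (j , star≡) = find in j , trans (inc-vertex (prev i) (outp (prev i) p) j) (trans (cong (global (prev i)) star≡) own≡)
    where
    first-three : own-tail i o ≡ before p ⊎ own-head i o ≡ before p → p ↑ˡ ni i ≡ o
    first-three eq with splitAt 3 o in s
    first-three (inj₁ refl) | inj₁ _ = splitAt⁻¹-↑ˡ s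
    first-three (inj₂ ())   | inj₁ _
    first-three (inj₁ ())   | inj₂ _
    first-three (inj₂ ())   | inj₂ _
    out : Local (prev i)
    out = (3 + ni (prev i)) ↑ʳ p
    find : Σ (Fin 3) λ j → star (prev i) (outp (prev i) p) j ≡ out
    find = subst (W.Listed (prev i) out) (cong [ own-tail (prev i) , inside ∘ outp (prev i) ]′ (splitAt-↑ʳ (3 + ni (prev i)) 3 p))
             (proj₁ (W.listed (prev i) out))
    own≡ : global (prev i) out ≡ own i o
    own≡ = trans (cong [ own (prev i) , inEdge (next (prev i)) ]′ (splitAt-↑ʳ (3 + ni (prev i)) 3 p))
             (trans (cong (λ k → inEdge k p) (next-prev i)) (cong (own i) (first-three eq)))

  I : Incidences H
  I = record
    { inc          = inc′
    ; inc-distinct = λ v → distinct′ (decode nv v)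
    ; inc-sound    = λ v → sound′ (decode nv v)
    ; inc-complete = λ e v → complete′ (decode nOwn e) (decode nv v)
    }
    where
    distinct′ : ∀ {v} → Encoded nv v → ∀ {j j'} → inc′ v j ≡ inc′ v j' → j ≡ j'
    distinct′ (at i x) {j} {j'} eq = W.star-inj i x j j'
      (global-injective i _ _ (trans (sym (inc-vertex i x j)) (trans eq (inc-vertex i x j'))))
    sound′ : ∀ {v} → Encoded nv v → ∀ j → End H (inc′ v j) v
    sound′ (at i x) j rewrite inc-vertex i x j with W.touching i x j
    ... | inj₁ t = inj₁ (trans (src-global i (star i x j)) (cong (place i) t))
    ... | inj₂ h = inj₂ (trans (tgt-global i (star i x j)) (cong (place i) h))
    complete′ : ∀ {e v} → Encoded nOwn e → Encoded nv v → End H e v → Σ (Fin 3) λ j → inc′ v j ≡ e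
    complete′ (at i o) (at k x) (inj₁ s) = own-listed i o _ (inj₁ refl) k x (trans (sym (src-own i o)) s)
    complete′ (at i o) (at k x) (inj₂ t) = own-listed i o _ (inj₂ refl) k x (trans (sym (tgt-own i o)) t)

  open CubicGraph H I
  open Flows H I

  module RingCut (X : Fin nV′ → Bool) where

    labelling : ∀ i → W.Labelling i
    labelling i = record
      { left  = λ p → X (place i (before p))
      ; right = λ p → X (place i (after p))
      ; label = λ x → X (vertex i x) }

    module L (i : Fin (suc m)) = W.Labelling i (labelling i)

    inCut inner : Fin (suc m) → ℕ
    inCut i = ℕΣ.sum {3} (bit ∘ cut X ∘ inEdge i)
    inner i = L.innerCut i

    Const : Fin (suc m) → Bool → Set
    Const i c = ∀ x → X (vertex i x) ≡ c

    value-place : ∀ i a → L.value i a ≡ X (place i a)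
    value-place i (before _) = refl
    value-place i (after _)  = refl
    value-place i (inside _) = refl

    cut-global : ∀ i e → L.cutAt i e ≡ cut X (global i e)
    cut-global i e = cong₂ _xor_
      (trans (value-place i (local-tail i e)) (cong X (sym (src-global i e))))
      (trans (value-place i (local-head i e)) (cong X (sym (tgt-global i e))))

    locally-stable : Stable X → ∀ i → L.LocallyStable i
    locally-stable X-stable i x = subst (_≤ 1)
      (ℕΣ.sum-cong-≗ λ j → cong bit (trans (cong (cut X) (inc-vertex i x j)) (sym (cut-global i (star i x j)))))
      (X-stable (vertex i x))

    cut-in : ∀ i p → cut X (inEdge i p) ≡ X (vertex (prev i) (outp (prev i) p)) xor X (vertex i (inp i p))
    cut-in i p = cong₂ _xor_
      (cong X (trans (src-own i (p ↑ˡ ni i)) (cong (place i ∘ [ before , _ ]′) (splitAt-↑ˡ 3 p (ni i)))))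
      (cong X (trans (tgt-own i (p ↑ˡ ni i)) (cong (place i ∘ [ inside ∘ inp i , _ ]′) (splitAt-↑ˡ 3 p (ni i)))))

    cut-own : ∀ i → ℕΣ.sum (bit ∘ cut X ∘ own i) ≡ inCut i + inner i
    cut-own i = trans (ℕΣ.sum-split 3 (bit ∘ cut X ∘ own i)) (cong (inCut i +_)
      (ℕΣ.sum-cong-≗ λ k → cong bit (cong₂ _xor_ (cong X (src-own i (3 ↑ʳ k))) (cong X (tgt-own i (3 ↑ʳ k))))))

    cutSize≡ : cutSize H X ≡ ℕΣ.sum inCut + ℕΣ.sum inner
    cutSize≡ = begin
      cutSize H X                                  ≡⟨ count≡sum (cut X) ⟩
      ℕΣ.sum (bit ∘ cut X)                         ≡⟨ ℕΣ.sum-blocks nOwn (bit ∘ cut X) ⟩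
      ℕΣ.sum (λ i → ℕΣ.sum (bit ∘ cut X ∘ own i))  ≡⟨ ℕΣ.sum-cong-≗ cut-own ⟩
      ℕΣ.sum (λ i → inCut i + inner i)             ≡⟨ ℕΣ.∑-distrib-+ inCut inner ⟩
      ℕΣ.sum inCut + ℕΣ.sum inner                  ∎
      where open ≡-Reasoning

    fullCut≡ : ∀ i → L.fullCut i ≡ (inCut i + inner i) + inCut (next i)
    fullCut≡ i = begin
      L.fullCut i                       ≡⟨ ℕΣ.sum-cong-≗ (λ e → cong bit (cut-global i e)) ⟩
      ℕΣ.sum g                          ≡⟨ ℕΣ.sum-split (3 + ni i) g ⟩
      ℕΣ.sum {3 + ni i} (λ o → g (o ↑ˡ 3)) + ℕΣ.sum {3} (λ p → g ((3 + ni i) ↑ʳ p)) ≡⟨ cong₂ _+_ owns outs ⟩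
      (inCut i + inner i) + inCut (next i) ∎
      where
      open ≡-Reasoning
      g : Local i → ℕ
      g = bit ∘ cut X ∘ global i
      owns : ℕΣ.sum {3 + ni i} (λ o → g (o ↑ˡ 3)) ≡ inCut i + inner i
      owns = trans (ℕΣ.sum-cong-≗ {3 + ni i} {λ o → g (o ↑ˡ 3)} {bit ∘ cut X ∘ own i}
        (λ o → cong (bit ∘ cut X ∘ [ own i , inEdge (next i) ]′) (splitAt-↑ˡ (3 + ni i) o 3))) (cut-own i)
      outs : ℕΣ.sum {3} (λ p → g ((3 + ni i) ↑ʳ p)) ≡ inCut (next i)
      outs = ℕΣ.sum-cong-≗ {3} {λ p → g ((3 + ni i) ↑ʳ p)}
        (λ p → cong (bit ∘ cut X ∘ [ own i , inEdge (next i) ]′) (splitAt-↑ʳ (3 + ni i) 3 p))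

    inner-const : ∀ i {c} → Const i c → inner i ≡ 0
    inner-const i const-c = ℕΣ.sum-ε {ni i} λ k → cong bit (xor-equal (trans (const-c _) (sym (const-c _))))

    step-const : ∀ k {c c'} → Const (prev k) c → Const k c' → c ≡ c' ⊎ 3 ≤ inCut k
    step-const k {c} {c'} const-c const-c' with c ≟ᵇ c'
    ... | yes c≡c' = inj₁ c≡c'
    ... | no  c≢c' = inj₂ (≤-reflexive (sym (ℕΣ.sum-cong-≗ λ p → cong bit
            (trans (cut-in k p) (trans (cong₂ _xor_ (const-c _) (const-c' _)) (different c c' c≢c'))))))
      where
      different : ∀ a b → a ≢ b → a xor b ≡ true
      different true  true  a≢b = ⊥-elim (a≢b refl)
      different true  false a≢b = refl
      different false true  a≢b = refl
      different false false a≢b = ⊥-elim (a≢b refl)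

    step-mixed : ∀ k {c} → L.MixedOut (prev k) → Const k c → 1 ≤ inCut k
    step-mixed k {c} mixed const-c with any? (λ p → cut X (inEdge k p) ≟ᵇ true)
    ... | yes (p , eq) = ≤-trans (≤-reflexive (sym (cong bit eq))) (term≤sum (bit ∘ cut X ∘ inEdge k) p)
    ... | no none = ⊥-elim (mixed (c , λ p → trans (uncut _ _ (λ eq → none (p , trans (cut-in k p) eq))) (const-c _)))
      where
      uncut : ∀ a b → a xor b ≢ true → a ≡ b
      uncut true  true  _    = refl
      uncut true  false a⊕b≢ = ⊥-elim (a⊕b≢ refl)
      uncut false true  a⊕b≢ = ⊥-elim (a⊕b≢ refl)
      uncut false false _    = refl

  module _ (strict : Fin (suc m))
    (inner-bound : ∀ i (K : W.Labelling i) → W.Labelling.LocallyStable i K → W.Labelling.Constant i K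
      ⊎ 3 ≤ W.Labelling.innerCut i K ⊎ (i ≢ strict × 2 ≤ W.Labelling.innerCut i K × W.Labelling.MixedOut i K))
    (full-bound : ∀ i c (K : W.Labelling i) → W.Labelling.LocallyStable i K →
      (∀ p → W.Labelling.left K p ≡ c) → (∀ p → W.Labelling.right K p ≡ c) →
      W.Labelling.Constant i K ⊎ 5 ≤ W.Labelling.fullCut i K) where

    large-stable-cut : ∀ X → Stable X → ∀ u v → X u ≡ true → X v ≡ false → 5 ≤ cutSize H X
    large-stable-cut X X-stable u v Xu Xv = decidable-stable (5 ≤? cutSize H X) λ 5≰ →
      FewCutEdges.impossible m≢0 inCut inner Const L.MixedOut strict
        (λ i → inner-bound i (labelling i) (locally-stable X-stable i)) inner-const step-const step-mixed
        (λ i {c} const-prev const-next → subst (λ k → L.Constant i ⊎ 5 ≤ k) (fullCut≡ i)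
          (full-bound i c (labelling i) (locally-stable X-stable i) (λ p → const-prev _) (λ p → const-next _)))
        not-all-const (λ 5≤ → 5≰ (subst (5 ≤_) (sym cutSize≡) 5≤))
      where
      open RingCut X
      not-all-const : ∀ c → ¬ (∀ i → Const i c)
      not-all-const c all = true≢false (trans (sym Xu) (trans (everywhere u) (trans (sym (everywhere v)) Xv)))
        where
        everywhere : ∀ w → X w ≡ c
        everywhere w with decode nv w
        ... | at i x = all i x

  flux : (Fin nE′ → Z2²) → Fin (suc m) → Z2²
  flux g i = ZΣ.sum {3} (g ∘ inEdge i)

  module _ (g : Fin nE′ → Z2²) (balanced : ∀ v → net g v ≡ zero²) where

    private
      module _ (i : Fin (suc m)) where
        X : Fin nV′ → Bool
        X w = ⌊ proj₁ (dec nv w) ≟ i ⌋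

        X-vertex : ∀ j x → X (vertex j x) ≡ ⌊ j ≟ i ⌋
        X-vertex j x = cong (λ (k , _) → ⌊ k ≟ i ⌋) (dec-enc nv j x)

        crossing : Fin nE′ → Z2²
        crossing e = if cut X e then g e else zero²

        enters : Fin (suc m) → Bool
        enters j = ⌊ prev j ≟ i ⌋ xor ⌊ j ≟ i ⌋

        crossing-in : ∀ j p → crossing (inEdge j p) ≡ (if enters j then g (inEdge j p) else zero²)
        crossing-in j p = cong (λ b → if b then g (inEdge j p) else zero²)
          (trans (RingCut.cut-in X j p) (cong₂ _xor_ (X-vertex (prev j) _) (X-vertex j _)))

        crossing-inner : ∀ j k → crossing (own j (3 ↑ʳ k)) ≡ zero²
        crossing-inner j k = cong (λ b → if b then g (own j (3 ↑ʳ k)) else zero²) (xor-equal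
          (trans (trans (cong X (src-own j (3 ↑ʳ k))) (X-vertex j _))
            (sym (trans (cong X (tgt-own j (3 ↑ʳ k))) (X-vertex j _)))))

        if-sum : ∀ (b : Bool) {n} (h : Fin n → Z2²) → ZΣ.sum (λ p → if b then h p else zero²) ≡ (if b then ZΣ.sum h else zero²)
        if-sum true  h = refl
        if-sum false {n} h = ZΣ.sum-ε {n} {λ _ → zero²} (λ _ → refl)

        crossing-pole : ∀ j → ZΣ.sum (crossing ∘ own j) ≡ (if enters j then flux g j else zero²)
        crossing-pole j = begin
          ZΣ.sum (crossing ∘ own j)
            ≡⟨ ZΣ.sum-split 3 (crossing ∘ own j) ⟩
          ZΣ.sum {3} (crossing ∘ inEdge j) ⊕ ZΣ.sum (λ k → crossing (own j (3 ↑ʳ k)))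
            ≡⟨ cong₂ _⊕_ (ZΣ.sum-cong-≗ {3} (crossing-in j)) (ZΣ.sum-ε {ni j} (crossing-inner j)) ⟩
          ZΣ.sum {3} (λ p → if enters j then g (inEdge j p) else zero²) ⊕ zero²
            ≡⟨ ⊕-identityʳ (ZΣ.sum {3} (λ p → if enters j then g (inEdge j p) else zero²)) ⟩
          ZΣ.sum {3} (λ p → if enters j then g (inEdge j p) else zero²)
            ≡⟨ if-sum (enters j) {3} (g ∘ inEdge j) ⟩
          (if enters j then flux g j else zero²) ∎
          where open ≡-Reasoning

        two-connectors : ∀ j → (if enters j then flux g j else zero²)
          ≡ ((if ⌊ j ≟ i ⌋ then flux g j else zero²) ⊕ (if ⌊ j ≟ next i ⌋ then flux g j else zero²))
        two-connectors j with prev j ≟ i | j ≟ i | j ≟ next i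
        ... | yes p | yes q | _ = ⊥-elim (prev≢ m≢0 j (trans p (sym q)))
        ... | yes p | no _  | yes _ = refl
        ... | yes p | no _  | no r  = ⊥-elim (r (trans (sym (next-prev j)) (cong next p)))
        ... | no p  | _     | yes r = ⊥-elim (p (trans (cong prev r) (prev-next i)))
        ... | no _  | yes _ | no _  = sym (⊕-identityʳ (flux g j))
        ... | no _  | no _  | no _  = refl

        -- Kirchhoff's law summed over the vertices of pole `i`: only its two connectors leave it.
        flux-next : (flux g i ⊕ flux g (next i)) ≡ zero²
        flux-next = begin
          flux g i ⊕ flux g (next i)
            ≡⟨ cong₂ _⊕_ (ZΣ.sum-δ i (flux g)) (ZΣ.sum-δ (next i) (flux g)) ⟨
          ZΣ.sum (λ j → if ⌊ j ≟ i ⌋ then flux g j else zero²) ⊕ ZΣ.sum (λ j → if ⌊ j ≟ next i ⌋ then flux g j else zero²)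
            ≡⟨ ZΣ.∑-distrib-+ (λ j → if ⌊ j ≟ i ⌋ then flux g j else zero²) (λ j → if ⌊ j ≟ next i ⌋ then flux g j else zero²) ⟨
          ZΣ.sum (λ j → (if ⌊ j ≟ i ⌋ then flux g j else zero²) ⊕ (if ⌊ j ≟ next i ⌋ then flux g j else zero²))
            ≡⟨ ZΣ.sum-cong-≗ (λ j → trans (crossing-pole j) (two-connectors j)) ⟨
          ZΣ.sum (λ j → ZΣ.sum (crossing ∘ own j))
            ≡⟨ ZΣ.sum-blocks nOwn crossing ⟨
          ZΣ.sum crossing
            ≡⟨ net-across-cut X g ⟨
          ZΣ.sum (λ v → if X v then net g v else zero²)
            ≡⟨ ZΣ.sum-ε (λ v → trans (cong (λ z → if X v then z else zero²) (balanced v)) (if-same (X v))) ⟩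
          zero² ∎
          where
          open ≡-Reasoning
          if-same : ∀ b → (if b then zero² else zero²) ≡ zero²
          if-same true  = refl
          if-same false = refl

    flux-constant : ∀ i → flux g i ≡ flux g zero
    flux-constant = cyclic-induction (λ i → flux g i ≡ flux g zero)
      (λ k eq → trans (sym (trans (⊕-cancel _ _ (flux-next (prev k))) (cong (flux g) (next-prev k)))) eq) zero refl

    -- The zero lies on an edge owned by pole `i`, so different poles yield different zeros.
    zero-in-pole : ∀ i {excluded} → FlowSearch.Refuted (P i) excluded → excluded (flux g i) ≡ false →
      Σ (Own i) λ o → g (own i o) ≡ zero²
    zero-in-pole i {excluded} refutation allowed with any? (λ o → g (own i o) ≟² zero²)
    ... | yes found = found
    ... | no none = ⊥-elim (FlowSearch.no-nonzero-flow (P i) excluded (g ∘ global i)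
            (λ x → trans (ZΣ.sum-cong-≗ {3} (λ j → cong g (sym (inc-vertex i x j)))) (balanced (vertex i x)))
            (λ o eq → none (o , trans (sym (g-own o)) eq))
            (trans (cong excluded (ZΣ.sum-cong-≗ {3} (λ p → g-own (p ↑ˡ ni i)))) allowed)
            refutation)
      where
      g-own : ∀ o → g (global i (o ↑ˡ 3)) ≡ g (own i o)
      g-own o = cong (g ∘ [ own i , inEdge (next i) ]′) (splitAt-↑ˡ (3 + ni i) o 3)

  count-own : ∀ (S : Fin nE′ → Bool) → count S ≡ ℕΣ.sum (λ i → ℕΣ.sum (bit ∘ S ∘ own i))
  count-own S = trans (count≡sum S) (ℕΣ.sum-blocks nOwn (bit ∘ S))

-- The three poles

-- Vertices 0-6 and 8: the Petersen graph minus two non-adjacent vertices; the others: the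
-- Petersen graph minus a path on four vertices.
poleA′ : Pole
poleA′ = record
  { nv   = 14
  ; ni   = 18
  ; ends = lookup (
      (# 0 , # 1) ∷ (# 1 , # 2) ∷ (# 0 , # 3) ∷ (# 2 , # 4) ∷ (# 3 , # 4) ∷ (# 4 , # 5) ∷
      (# 0 , # 6) ∷ (# 5 , # 6) ∷ (# 6 , # 7) ∷ (# 3 , # 8) ∷ (# 7 , # 9) ∷ (# 2 , # 10) ∷
      (# 9 , # 10) ∷ (# 9 , # 11) ∷ (# 8 , # 12) ∷ (# 11 , # 12) ∷ (# 10 , # 13) ∷ (# 12 , # 13) ∷ [])
  ; inp  = lookup (# 8 ∷ # 5 ∷ # 1 ∷ [])
  ; outp = lookup (# 11 ∷ # 13 ∷ # 7 ∷ [])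
  ; star = λ v → lookup (lookup (
      (# 3 ∷ # 5 ∷ # 9 ∷ []) ∷ (# 2 ∷ # 3 ∷ # 4 ∷ []) ∷ (# 4 ∷ # 6 ∷ # 14 ∷ []) ∷
      (# 5 ∷ # 7 ∷ # 12 ∷ []) ∷ (# 6 ∷ # 7 ∷ # 8 ∷ []) ∷ (# 1 ∷ # 8 ∷ # 10 ∷ []) ∷
      (# 9 ∷ # 10 ∷ # 11 ∷ []) ∷ (# 11 ∷ # 13 ∷ # 23 ∷ []) ∷ (# 0 ∷ # 12 ∷ # 17 ∷ []) ∷
      (# 13 ∷ # 15 ∷ # 16 ∷ []) ∷ (# 14 ∷ # 15 ∷ # 19 ∷ []) ∷ (# 16 ∷ # 18 ∷ # 21 ∷ []) ∷
      (# 17 ∷ # 18 ∷ # 20 ∷ []) ∷ (# 19 ∷ # 20 ∷ # 22 ∷ []) ∷ []) v)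
  }

-- The same first part, followed by a claw.
poleA : Pole
poleA = record
  { nv   = 12
  ; ni   = 15
  ; ends = lookup (
      (# 0 , # 1) ∷ (# 0 , # 2) ∷ (# 2 , # 3) ∷ (# 1 , # 4) ∷ (# 3 , # 4) ∷ (# 3 , # 5) ∷
      (# 1 , # 6) ∷ (# 5 , # 6) ∷ (# 2 , # 7) ∷ (# 4 , # 8) ∷ (# 6 , # 9) ∷ (# 7 , # 10) ∷
      (# 9 , # 10) ∷ (# 8 , # 11) ∷ (# 10 , # 11) ∷ [])
  ; inp  = lookup (# 8 ∷ # 0 ∷ # 5 ∷ [])
  ; outp = lookup (# 11 ∷ # 9 ∷ # 7 ∷ [])
  ; star = λ v → lookup (lookup (
      (# 1 ∷ # 3 ∷ # 4 ∷ []) ∷ (# 3 ∷ # 6 ∷ # 9 ∷ []) ∷ (# 4 ∷ # 5 ∷ # 11 ∷ []) ∷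
      (# 5 ∷ # 7 ∷ # 8 ∷ []) ∷ (# 6 ∷ # 7 ∷ # 12 ∷ []) ∷ (# 2 ∷ # 8 ∷ # 10 ∷ []) ∷
      (# 9 ∷ # 10 ∷ # 13 ∷ []) ∷ (# 11 ∷ # 14 ∷ # 20 ∷ []) ∷ (# 0 ∷ # 12 ∷ # 16 ∷ []) ∷
      (# 13 ∷ # 15 ∷ # 19 ∷ []) ∷ (# 14 ∷ # 15 ∷ # 17 ∷ []) ∷ (# 16 ∷ # 17 ∷ # 18 ∷ []) ∷ []) v)
  }

-- Vertices 0-9 and 16-25: the Petersen graph with three edges cut open; 10-15: the Petersen
-- graph minus a path on four vertices.  The edge 26-27 joins two of the last three dangling edges,
-- so that zeros forced by consecutive B's are distinct.
poleB : Pole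
poleB = record
  { nv   = 28
  ; ni   = 39
  ; ends = lookup (
      (# 0 , # 1) ∷ (# 0 , # 2) ∷ (# 2 , # 3) ∷ (# 1 , # 4) ∷ (# 3 , # 4) ∷ (# 3 , # 5) ∷
      (# 1 , # 6) ∷ (# 5 , # 6) ∷ (# 4 , # 7) ∷ (# 6 , # 8) ∷ (# 7 , # 8) ∷ (# 5 , # 9) ∷
      (# 9 , # 10) ∷ (# 10 , # 11) ∷ (# 2 , # 12) ∷ (# 11 , # 12) ∷ (# 10 , # 13) ∷ (# 8 , # 14) ∷
      (# 13 , # 14) ∷ (# 11 , # 15) ∷ (# 14 , # 15) ∷ (# 15 , # 16) ∷ (# 16 , # 17) ∷
      (# 17 , # 18) ∷ (# 13 , # 19) ∷ (# 18 , # 19) ∷ (# 17 , # 20) ∷ (# 12 , # 21) ∷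
      (# 20 , # 21) ∷ (# 21 , # 22) ∷ (# 18 , # 23) ∷ (# 22 , # 23) ∷ (# 20 , # 24) ∷
      (# 23 , # 24) ∷ (# 19 , # 25) ∷ (# 24 , # 25) ∷ (# 25 , # 26) ∷ (# 22 , # 27) ∷
      (# 26 , # 27) ∷ [])
  ; inp  = lookup (# 7 ∷ # 9 ∷ # 0 ∷ [])
  ; outp = lookup (# 26 ∷ # 16 ∷ # 27 ∷ [])
  ; star = λ v → lookup (lookup (
      (# 2 ∷ # 3 ∷ # 4 ∷ []) ∷ (# 3 ∷ # 6 ∷ # 9 ∷ []) ∷ (# 4 ∷ # 5 ∷ # 17 ∷ []) ∷
      (# 5 ∷ # 7 ∷ # 8 ∷ []) ∷ (# 6 ∷ # 7 ∷ # 11 ∷ []) ∷ (# 8 ∷ # 10 ∷ # 14 ∷ []) ∷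
      (# 9 ∷ # 10 ∷ # 12 ∷ []) ∷ (# 0 ∷ # 11 ∷ # 13 ∷ []) ∷ (# 12 ∷ # 13 ∷ # 20 ∷ []) ∷
      (# 1 ∷ # 14 ∷ # 15 ∷ []) ∷ (# 15 ∷ # 16 ∷ # 19 ∷ []) ∷ (# 16 ∷ # 18 ∷ # 22 ∷ []) ∷
      (# 17 ∷ # 18 ∷ # 30 ∷ []) ∷ (# 19 ∷ # 21 ∷ # 27 ∷ []) ∷ (# 20 ∷ # 21 ∷ # 23 ∷ []) ∷
      (# 22 ∷ # 23 ∷ # 24 ∷ []) ∷ (# 24 ∷ # 25 ∷ # 43 ∷ []) ∷ (# 25 ∷ # 26 ∷ # 29 ∷ []) ∷
      (# 26 ∷ # 28 ∷ # 33 ∷ []) ∷ (# 27 ∷ # 28 ∷ # 37 ∷ []) ∷ (# 29 ∷ # 31 ∷ # 35 ∷ []) ∷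
      (# 30 ∷ # 31 ∷ # 32 ∷ []) ∷ (# 32 ∷ # 34 ∷ # 40 ∷ []) ∷ (# 33 ∷ # 34 ∷ # 36 ∷ []) ∷
      (# 35 ∷ # 36 ∷ # 38 ∷ []) ∷ (# 37 ∷ # 38 ∷ # 39 ∷ []) ∷ (# 39 ∷ # 41 ∷ # 42 ∷ []) ∷
      (# 40 ∷ # 41 ∷ # 44 ∷ []) ∷ []) v)
  }

-- Certificates for the poles: refutations, cut bounds, colourings and flows

flux-zero flux-nonzero : Z2² → Bool
flux-zero s    = ⌊ s ≟² zero² ⌋
flux-nonzero s = not ⌊ s ≟² zero² ⌋

-- The order runs through the in-edges and the edges inside the Petersen part only. The three edges
-- that leave this part are still owned by the pole, so requiring them to be nonzero is legitimate,
-- and a surviving branch would colour the Petersen graph.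
refutedA′ : FlowSearch.Refuted poleA′ flux-nonzero
refutedA′ = FlowSearch.refuted (
    # 1 ∷ # 0 ∷ # 2 ∷ # 8 ∷ # 10 ∷ # 9 ∷ # 3 ∷ # 5 ∷ # 12 ∷ # 7 ∷ # 4 ∷ # 6 ∷ [])
  refl

refutedA : FlowSearch.Refuted poleA flux-nonzero
refutedA = FlowSearch.refuted (
    # 2 ∷ # 1 ∷ # 0 ∷ # 10 ∷ # 8 ∷ # 9 ∷ # 3 ∷ # 6 ∷ # 12 ∷ # 7 ∷ # 5 ∷ # 4 ∷ [])
  refl

-- The edges at 16, 26 and 27 get no value in the search: at 15, 17, 22 and 25 it is enough that the
-- owned edges towards them are nonzero.
refutedB : FlowSearch.Refuted poleB flux-zero
refutedB = FlowSearch.refuted (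
    # 12 ∷ # 13 ∷ # 20 ∷ # 9 ∷ # 10 ∷ # 0 ∷ # 11 ∷ # 6 ∷ # 3 ∷ # 7 ∷ # 8 ∷ # 14 ∷ # 5 ∷ # 4 ∷
    # 17 ∷ # 2 ∷ # 1 ∷ # 15 ∷ # 18 ∷ # 16 ∷ # 22 ∷ # 19 ∷ # 23 ∷ # 21 ∷ # 27 ∷ # 30 ∷ # 32 ∷ # 31 ∷
    # 37 ∷ # 28 ∷ # 33 ∷ # 34 ∷ # 36 ∷ # 38 ∷ # 35 ∷ # 26 ∷ # 29 ∷ [])
  refl

-- That the check passes with `mixed` false makes this the strict pole, which stands at index zero
-- of the ring.
innerA′ : PoleTheory.CutSearch.Checked poleA′ nothing false 3
innerA′ = PoleTheory.CutSearch.checked _ refl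

fullA′ : ∀ c → PoleTheory.CutSearch.Checked poleA′ (just c) false 5
fullA′ false = PoleTheory.CutSearch.checked _ refl
fullA′ true  = PoleTheory.CutSearch.checked _ refl

-- Here `mixed` has to be true: labelling just the vertices 8 and 11, a path from in-edge 0 to
-- out-edge 0, cuts only the inner edges 4-8 and 10-11.
innerA : PoleTheory.CutSearch.Checked poleA nothing true 3
innerA = PoleTheory.CutSearch.checked _ refl

fullA : ∀ c → PoleTheory.CutSearch.Checked poleA (just c) false 5
fullA false = PoleTheory.CutSearch.checked _ refl
fullA true  = PoleTheory.CutSearch.checked _ refl

innerB : PoleTheory.CutSearch.Checked poleB nothing true 3
innerB = PoleTheory.CutSearch.checked _ refl

fullB : ∀ c → PoleTheory.CutSearch.Checked poleB (just c) false 5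
fullB false = PoleTheory.CutSearch.checked _ refl
fullB true  = PoleTheory.CutSearch.checked _ refl

-- Both A colourings have in-colours 0, 1, 1, with nonzero sum, while B has 0, 1, 2, with sum zero.
-- The triples differ only on in-edge 2, so leaving that edge uncoloured is enough where the sum
-- changes.
colouringA′ : Vec (Fin 3) (3 + Pole.ni poleA′)
colouringA′ =
  # 0 ∷ # 1 ∷ # 1 ∷ # 0 ∷ # 2 ∷ # 2 ∷ # 1 ∷ # 0 ∷ # 2 ∷ # 1 ∷ # 0 ∷ # 2 ∷ # 1 ∷ # 0 ∷ # 0 ∷ # 1 ∷
  # 2 ∷ # 2 ∷ # 1 ∷ # 2 ∷ # 0 ∷ []

colouringA : Vec (Fin 3) (3 + Pole.ni poleA)
colouringA =
  # 0 ∷ # 1 ∷ # 1 ∷ # 0 ∷ # 2 ∷ # 1 ∷ # 2 ∷ # 0 ∷ # 2 ∷ # 1 ∷ # 0 ∷ # 0 ∷ # 1 ∷ # 2 ∷ # 2 ∷ # 0 ∷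
  # 2 ∷ # 1 ∷ []

colouringB : Vec (Fin 3) (3 + Pole.ni poleB)
colouringB =
  # 0 ∷ # 1 ∷ # 2 ∷ # 0 ∷ # 1 ∷ # 2 ∷ # 2 ∷ # 0 ∷ # 1 ∷ # 1 ∷ # 2 ∷ # 1 ∷ # 0 ∷ # 2 ∷ # 0 ∷ # 2 ∷
  # 0 ∷ # 0 ∷ # 2 ∷ # 1 ∷ # 1 ∷ # 0 ∷ # 1 ∷ # 2 ∷ # 0 ∷ # 2 ∷ # 0 ∷ # 2 ∷ # 1 ∷ # 1 ∷ # 1 ∷ # 0 ∷
  # 2 ∷ # 2 ∷ # 1 ∷ # 2 ∷ # 0 ∷ # 0 ∷ # 1 ∷ # 2 ∷ # 0 ∷ # 1 ∷ []

-- The in-edges carry 0, 1, 2 as in `colouringB`, so all connectors of the ring have the same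
-- values. The value zero enters only through `masked`, at one edge of each A.
flowA′ : Vec (Fin 3) (3 + Pole.ni poleA′)
flowA′ =
  # 0 ∷ # 1 ∷ # 2 ∷ # 0 ∷ # 1 ∷ # 1 ∷ # 0 ∷ # 1 ∷ # 2 ∷ # 2 ∷ # 0 ∷ # 1 ∷ # 0 ∷ # 0 ∷ # 2 ∷ # 1 ∷
  # 2 ∷ # 0 ∷ # 1 ∷ # 0 ∷ # 2 ∷ []

flowA : Vec (Fin 3) (3 + Pole.ni poleA)
flowA =
  # 0 ∷ # 1 ∷ # 2 ∷ # 0 ∷ # 2 ∷ # 0 ∷ # 0 ∷ # 2 ∷ # 1 ∷ # 0 ∷ # 0 ∷ # 1 ∷ # 1 ∷ # 0 ∷ # 0 ∷ # 2 ∷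
  # 2 ∷ # 1 ∷ []

-- b′ is the first B of the ring.
data Kind : Set where
  a′ a b′ b : Kind

pole : Kind → Pole
pole a′ = poleA′
pole a  = poleA
pole b′ = poleB
pole b  = poleB

OwnOf LocalOf : Kind → Set
OwnOf k   = Pole.Own (pole k)
LocalOf k = Pole.Local (pole k)

wellFormed : ∀ k → PoleTheory.WellFormed (pole k)
wellFormed a′ = toWitness {a? = PoleTheory.wellFormed? poleA′} _
wellFormed a  = toWitness {a? = PoleTheory.wellFormed? poleA} _
wellFormed b′ = toWitness {a? = PoleTheory.wellFormed? poleB} _
wellFormed b  = toWitness {a? = PoleTheory.wellFormed? poleB} _

colouring flow : ∀ k → OwnOf k → Fin 3
colouring a′ = lookup colouringA′
colouring a  = lookup colouringA
colouring b′ = lookup colouringB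
colouring b  = lookup colouringB
flow a′ = lookup flowA′
flow a  = lookup flowA
flow b′ = lookup colouringB
flow b  = lookup colouringB

-- Edge 2 is the in-edge at which the sum of the connector changes.
uncoloured zeros : ∀ k → OwnOf k → Bool
uncoloured a′ o = ⌊ o ≟ # 2 ⌋
uncoloured a  o = false
uncoloured b′ o = ⌊ o ≟ # 2 ⌋
uncoloured b  o = false
zeros a′ o = ⌊ o ≟ # 12 ⌋
zeros a  o = ⌊ o ≟ # 9 ⌋
zeros b′ o = false
zeros b  o = false

-- The eight successions that occur in the rings. The conditions at a pole involve the rest of the
-- ring only through the in-edges of the next pole, so eight finite checks settle colouring and flow
-- for every `n`.
follows : Kind → Kind → Bool
follows a′ a  = true
follows a′ b′ = true
follows a  a  = true
follows a  b′ = true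
follows b′ a′ = true
follows b′ b  = true
follows b  a′ = true
follows b  b  = true
follows _  _  = false

locally : ∀ {A : Set} → (∀ k → OwnOf k → A) → ∀ k l → LocalOf k → A
locally t k l = [ t k , (λ p → t l (p ↑ˡ _)) ]′ ∘ splitAt (3 + Pole.ni (pole k))

masked : ∀ k → OwnOf k → Z2²
masked k o = if zeros k o then zero² else colour (flow k o)

Proper Balanced : Kind → Kind → Set
Proper k l = ∀ v i j → i ≢ j → missing v i ≡ false → missing v j ≡ false → paint v i ≢ paint v j
  where
  missing : Fin (Pole.nv (pole k)) → Fin 3 → Bool
  missing v j = locally uncoloured k l (Pole.star (pole k) v j)
  paint : Fin (Pole.nv (pole k)) → Fin 3 → Fin 3
  paint v j = locally colouring k l (Pole.star (pole k) v j)
Balanced k l = ∀ v → ZΣ.sum (λ j → locally masked k l (Pole.star (pole k) v j)) ≡ zero²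

proper? : ∀ k l → Dec (Proper k l)
proper? k l = all? λ v → all? λ i → all? λ j → ¬? (i ≟ j) →-dec
  (locally uncoloured k l (Pole.star (pole k) v i) ≟ᵇ false) →-dec
  (locally uncoloured k l (Pole.star (pole k) v j) ≟ᵇ false) →-dec
  ¬? (locally colouring k l (Pole.star (pole k) v i) ≟ locally colouring k l (Pole.star (pole k) v j))

balanced? : ∀ k l → Dec (Balanced k l)
balanced? k l = all? λ v → ZΣ.sum (λ j → locally masked k l (Pole.star (pole k) v j)) ≟² zero²

proper : ∀ k l → T (follows k l) → Proper k l
proper a′ a  _ = toWitness {a? = proper? a′ a} _
proper a′ b′ _ = toWitness {a? = proper? a′ b′} _
proper a  a  _ = toWitness {a? = proper? a a} _
proper a  b′ _ = toWitness {a? = proper? a b′} _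
proper b′ a′ _ = toWitness {a? = proper? b′ a′} _
proper b′ b  _ = toWitness {a? = proper? b′ b} _
proper b  a′ _ = toWitness {a? = proper? b a′} _
proper b  b  _ = toWitness {a? = proper? b b} _

balanced : ∀ k l → T (follows k l) → Balanced k l
balanced a′ a  _ = toWitness {a? = balanced? a′ a} _
balanced a′ b′ _ = toWitness {a? = balanced? a′ b′} _
balanced a  a  _ = toWitness {a? = balanced? a a} _
balanced a  b′ _ = toWitness {a? = balanced? a b′} _
balanced b′ a′ _ = toWitness {a? = balanced? b′ a′} _
balanced b′ b  _ = toWitness {a? = balanced? b′ b} _
balanced b  a′ _ = toWitness {a? = balanced? b a′} _
balanced b  b  _ = toWitness {a? = balanced? b b} _

-- The kinds around the ring

kinds : ∀ p q → Vec Kind (suc (p + suc q))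
kinds p q = a′ ∷ replicate p a ++ᵛ b′ ∷ replicate q b

Linked : ∀ {n} → Kind → Vec Kind n → Set
Linked k []       = ⊤
Linked k (l ∷ ls) = T (follows k l) × Linked l ls

linked-lookup : ∀ {n} k (ls : Vec Kind n) → Linked k ls → ∀ j →
  T (follows (lookup (k ∷ ls) (inject₁ j)) (lookup ls j))
linked-lookup k (l ∷ ls) (kl , _)    zero    = kl
linked-lookup k (l ∷ ls) (_ , rest)  (suc j) = linked-lookup l ls rest j

linked-b : ∀ k q → T (follows k b) → Linked k (replicate q b)
linked-b k zero    _  = tt
linked-b k (suc q) kb = kb , linked-b b q tt

linked-a : ∀ k p q → T (follows k a) → T (follows k b′) → Linked k (replicate p a ++ᵛ b′ ∷ replicate q b)
linked-a k zero    q _  kb′ = kb′ , linked-b b′ q tt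
linked-a k (suc p) q ka _   = ka , linked-a a p q tt tt

last-b : ∀ k q → T (follows k a′) → T (follows (lookup (k ∷ replicate q b) (fromℕ q)) a′)
last-b k zero    ka′ = ka′
last-b k (suc q) _   = last-b b q tt

last-a : ∀ k p q → T (follows (lookup (k ∷ replicate p a ++ᵛ b′ ∷ replicate q b) (fromℕ (p + suc q))) a′)
last-a k zero    q = last-b b′ q tt
last-a k (suc p) q = last-a a p q

kinds-follow : ∀ p q i → T (follows (lookup (kinds p q) (prev i)) (lookup (kinds p q) i))
kinds-follow p q zero    = last-a a′ p q
kinds-follow p q (suc i) = linked-lookup a′ _ (linked-a a′ p q tt tt) i

sum-replicate : ∀ (w : Kind → ℕ) k q → ℕΣ.sum (w ∘ lookup (replicate q k)) ≡ q * w k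
sum-replicate w k zero    = refl
sum-replicate w k (suc q) = cong (w k +_) (sum-replicate w k q)

sum-kinds : ∀ (w : Kind → ℕ) p q → ℕΣ.sum (w ∘ lookup (kinds p q)) ≡ w a′ + (p * w a + (w b′ + q * w b))
sum-kinds w p q = cong (w a′ +_) (go p)
  where
  go : ∀ p → ℕΣ.sum (w ∘ lookup (replicate p a ++ᵛ b′ ∷ replicate q b)) ≡ p * w a + (w b′ + q * w b)
  go zero    = cong (w b′ +_) (sum-replicate w b q)
  go (suc p) = trans (cong (w a +_) (go p)) (sym (+-assoc (w a) (p * w a) (w b′ + q * w b)))

inA inB : Kind → ℕ
inA a′ = 1
inA a  = 1
inA b′ = 0
inA b  = 0
inB a′ = 0
inB a  = 0
inB b′ = 1
inB b  = 1

refutationsA : ∀ k → inA k ≡ 0 ⊎ (inA k ≡ 1 × FlowSearch.Refuted (pole k) flux-nonzero)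
refutationsA a′ = inj₂ (refl , refutedA′)
refutationsA a  = inj₂ (refl , refutedA)
refutationsA b′ = inj₁ refl
refutationsA b  = inj₁ refl

refutationsB : ∀ k → inB k ≡ 0 ⊎ (inB k ≡ 1 × FlowSearch.Refuted (pole k) flux-zero)
refutationsB a′ = inj₁ refl
refutationsB a  = inj₁ refl
refutationsB b′ = inj₂ (refl , refutedB)
refutationsB b  = inj₂ (refl , refutedB)

total≡sum : ∀ {m} (sz : Fin m → ℕ) → total sz ≡ ℕΣ.sum sz
total≡sum {zero}  sz = refl
total≡sum {suc m} sz = cong (sz zero +_) (total≡sum (sz ∘ suc))

-- The ring with `suc n` poles of each kind

module Construction (n : ℕ) where

  κ : Fin (suc (n + suc n)) → Kind
  κ = lookup (kinds n n)

  open Ring (m+1+n≢0 n) (pole ∘ κ) (wellFormed ∘ κ)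
  open Incidences I
  open CubicGraph H I
  open Flows H I

  nVert : Fin (suc (n + suc n)) → ℕ
  nVert = Pole.nv ∘ pole ∘ κ

  nV-H : Graph.nV H ≡ 40 * suc n + 2
  nV-H = trans (total≡sum nVert) (trans (sum-kinds (Pole.nv ∘ pole) n n)
    (solve 1 (λ n → con 14 :+ (n :* con 12 :+ (con 28 :+ n :* con 28)) := con 40 :* (con 1 :+ n) :+ con 2) refl n))
    where open +-*-Solver

  mixed : Kind → Bool
  mixed a′ = false
  mixed _  = true

  stable-cuts : ∀ X → Stable X → ∀ u v → X u ≡ true → X v ≡ false → 5 ≤ cutSize H X
  stable-cuts = large-stable-cut zero (λ i → inner-bound i (κ i) refl) (λ i → full-bound (κ i))
    where
    open PoleTheory.Labelling
    inner-kind : ∀ k (K : PoleTheory.Labelling (pole k)) → LocallyStable K → Constant K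
      ⊎ 3 ≤ innerCut K ⊎ (T (mixed k) × 2 ≤ innerCut K × MixedOut K)
    inner-kind a′ = PoleTheory.inner-outcome poleA′ false innerA′
    inner-kind a  = PoleTheory.inner-outcome poleA true innerA
    inner-kind b′ = PoleTheory.inner-outcome poleB true innerB
    inner-kind b  = PoleTheory.inner-outcome poleB true innerB
    full-bound : ∀ k c (K : PoleTheory.Labelling (pole k)) → LocallyStable K →
      (∀ p → left K p ≡ c) → (∀ p → right K p ≡ c) → Constant K ⊎ 5 ≤ fullCut K
    full-bound a′ c = PoleTheory.full-outcome poleA′ c (fullA′ c)
    full-bound a  c = PoleTheory.full-outcome poleA c (fullA c)
    full-bound b′ c = PoleTheory.full-outcome poleB c (fullB c)
    full-bound b  c = PoleTheory.full-outcome poleB c (fullB c)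
    inner-bound : ∀ i k → κ i ≡ k → (K : PoleTheory.Labelling (pole k)) → LocallyStable K → Constant K
      ⊎ 3 ≤ innerCut K ⊎ (i ≢ zero × 2 ≤ innerCut K × MixedOut K)
    inner-bound i k κi≡k K K-stable with inner-kind k K K-stable
    ... | inj₁ constant                = inj₁ constant
    ... | inj₂ (inj₁ 3≤)               = inj₂ (inj₁ 3≤)
    ... | inj₂ (inj₂ (mixed-k , 2≤ , out)) =
      -- Index zero has kind `a′`, for which `mixed` is false, so a mixed outcome happens elsewhere.
      inj₂ (inj₂ ((λ { refl → subst (T ∘ mixed) (sym κi≡k) mixed-k }) , 2≤ , out))

  open LargeStableCuts stable-cuts public using (cyclically-5-connected; two-connected)

  spread : ∀ {A : Set} → (∀ k → OwnOf k → A) → Fin (Graph.nE H) → A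
  spread t e = let (i , o) = dec nOwn e in t (κ i) o

  spread-own : ∀ {A : Set} (t : ∀ k → OwnOf k → A) i o → spread t (own i o) ≡ t (κ i) o
  spread-own t i o = cong (λ (i , o) → t (κ i) o) (dec-enc nOwn i o)

  spread-inc : ∀ {A : Set} (t : ∀ k → OwnOf k → A) i x j →
    spread t (inc (vertex i x) j) ≡ locally t (κ i) (κ (next i)) (Pole.star (pole (κ i)) x j)
  spread-inc t i x j = trans (cong (spread t) (inc-vertex i x j)) (global-value (Pole.star (pole (κ i)) x j))
    where
    global-value : ∀ e → spread t (global i e) ≡ locally t (κ i) (κ (next i)) e
    global-value e with splitAt (3 + Pole.ni (pole (κ i))) e
    ... | inj₁ o = spread-own t i o
    ... | inj₂ p = spread-own t (next i) (p ↑ˡ _)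

  follow : ∀ i → T (follows (κ i) (κ (next i)))
  follow i = subst (λ j → T (follows (κ j) (κ (next i)))) (prev-next i) (kinds-follow n n (next i))

  count-spread : ∀ (S : ∀ k → OwnOf k → Bool) (w : Kind → ℕ) → (∀ k → ℕΣ.sum (bit ∘ S k) ≡ w k) →
    count (spread S) ≡ w a′ + (n * w a + (w b′ + n * w b))
  count-spread S w weights = trans (count-own (spread S)) (trans (ℕΣ.sum-cong-≗ λ i →
    trans (ℕΣ.sum-cong-≗ (λ o → cong bit (spread-own S i o))) (weights (κ i))) (sum-kinds w n n))

  colourable : ColorableMinus H (spread uncoloured)
  colourable = spread colouring , differ
    where
    differ-at : ∀ {v} → Encoded nVert v → ∀ j j' → inc v j ≢ inc v j' → spread uncoloured (inc v j) ≡ false →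
      spread uncoloured (inc v j') ≡ false → spread colouring (inc v j) ≢ spread colouring (inc v j')
    differ-at (at i x) j j' e≢e' ¬S ¬S' eq = proper (κ i) (κ (next i)) (follow i) x j j' (e≢e' ∘ cong (inc (vertex i x)))
      (trans (sym (spread-inc uncoloured i x j)) ¬S) (trans (sym (spread-inc uncoloured i x j')) ¬S')
      (trans (sym (spread-inc colouring i x j)) (trans eq (spread-inc colouring i x j')))
    differ : ∀ e e' → e ≢ e' → spread uncoloured e ≡ false → spread uncoloured e' ≡ false →
      (Σ (Fin (Graph.nV H)) λ v → T (incident H e v) × T (incident H e' v)) → spread colouring e ≢ spread colouring e'
    differ e e' e≢e' ¬S ¬S' (v , ev , e'v)
      with inc-complete e v (T-incident {e} {v} ev) | inc-complete e' v (T-incident {e'} {v} e'v)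
    ... | j , refl | j' , refl = differ-at (decode nVert v) j j' e≢e' ¬S ¬S'

  nowhere-zero : NZFlowMinus H (spread zeros)
  nowhere-zero = colour ∘ spread flow , (λ e _ → colour≢0 _) , λ v → trans (sum²-mask (spread zeros) (colour ∘ spread flow) v) (kirchhoff (decode nVert v))
    where
    kirchhoff : ∀ {v} → Encoded nVert v → net (mask (spread zeros) (colour ∘ spread flow)) v ≡ zero²
    kirchhoff (at i x) = trans (ZΣ.sum-cong-≗ {3} λ j → spread-inc masked i x j) (balanced (κ i) (κ (next i)) (follow i) x)

  module _ (g : Fin (Graph.nE H) → Z2²) (g-balanced : ∀ v → net g v ≡ zero²)
    (S : Fin (Graph.nE H) → Bool) (zeros⊆S : ∀ e → g e ≡ zero² → S e ≡ true) where

    private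
      at-least : (w : Kind → ℕ) → w a′ + (n * w a + (w b′ + n * w b)) ≡ suc n →
        (∀ i → w (κ i) ≤ ℕΣ.sum (bit ∘ S ∘ own i)) → suc n ≤ count S
      at-least w total-w below = ≤-trans (≤-reflexive (sym (trans (sum-kinds w n n) total-w)))
        (≤-trans (sum-mono-≤ below) (≤-reflexive (sym (count-own S))))

      hit : ∀ i → Σ (Pole.Own (pole (κ i))) (λ o → g (own i o) ≡ zero²) → 1 ≤ ℕΣ.sum (bit ∘ S ∘ own i)
      hit i (o , g≡0) = ≤-trans (≤-reflexive (sym (cong bit (zeros⊆S _ g≡0)))) (term≤sum (bit ∘ S ∘ own i) o)

      weigh-in : (w : Kind → ℕ) (excluded : Z2² → Bool) → (∀ i → excluded (flux g i) ≡ false) →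
        (∀ k → w k ≡ 0 ⊎ (w k ≡ 1 × FlowSearch.Refuted (pole k) excluded)) →
        ∀ i → w (κ i) ≤ ℕΣ.sum (bit ∘ S ∘ own i)
      weigh-in w excluded allowed refutations i =
        [ (λ w≡0 → subst (_≤ _) (sym w≡0) z≤n)
        , (λ (w≡1 , refutation) → subst (_≤ _) (sym w≡1) (hit i (zero-in-pole g g-balanced i refutation (allowed i))))
        ]′ (refutations (κ i))

    -- The set `S` is kept apart from the zeros so that the bound serves twice: with `S` empty it
    -- rules out nowhere-zero flows, and with `S` the set of removed edges it bounds the flow
    -- resistance.
    many-zeros : suc n ≤ count S
    many-zeros with flux g zero ≟² zero²
    ... | yes s≡0 = at-least inA (solve 1 (λ n → con 1 :+ (n :* con 1 :+ (con 0 :+ n :* con 0)) := con 1 :+ n) refl n)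
            (weigh-in inA flux-nonzero (λ i → cong flux-nonzero (trans (flux-constant g g-balanced i) s≡0)) refutationsA)
      where open +-*-Solver
    ... | no s≢0 = at-least inB (solve 1 (λ n → con 0 :+ (n :* con 0 :+ (con 1 :+ n :* con 1)) := con 1 :+ n) refl n)
            (weigh-in inB flux-zero (λ i → trans (cong flux-zero (flux-constant g g-balanced i)) (≢0 s≢0)) refutationsB)
      where
      open +-*-Solver
      ≢0 : ∀ {s} → s ≢ zero² → flux-zero s ≡ false
      ≢0 {s} s≢0 with s ≟² zero²
      ... | yes s≡0 = ⊥-elim (s≢0 s≡0)
      ... | no _    = refl

  no-flow : ∀ f → (∀ e → f e ≢ zero²) → ¬ (∀ v → net f v ≡ zero²)
  no-flow f f≢0 f-balanced
    with () ← ≤-trans (many-zeros f f-balanced (λ _ → false) (λ e f≡0 → ⊥-elim (f≢0 e f≡0)))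
      (≤-reflexive (trans (count≡sum {Graph.nE H} (λ _ → false)) (ℕΣ.sum-ε {Graph.nE H} {λ _ → 0} (λ _ → refl))))

  snark : Snark H
  snark = two-connected (subst (3 ≤_) (sym nV-H) 3≤) , cubic , not-colourable no-flow
    where
    3≤ : 3 ≤ 40 * suc n + 2
    3≤ = s≤s (m≤n+m 2 (n + 39 * suc n))

  resistance : ResistanceIs H 2
  resistance = (spread uncoloured , count-uncoloured , colourable) , 2≤missing no-flow
    where
    open +-*-Solver
    -- The hole becomes the sum itself, which evaluates to a numeral on each of the four kinds.
    weights : ∀ k → ℕΣ.sum (bit ∘ uncoloured k) ≡ _
    weights _ = refl
    count-uncoloured : count (spread uncoloured) ≡ 2
    count-uncoloured = trans (count-spread uncoloured _ weights)
      (solve 1 (λ n → con 1 :+ (n :* con 0 :+ (con 1 :+ n :* con 0)) := con 2) refl n)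

  flow-resistance : FlowResistanceIs H (suc n)
  flow-resistance = (spread zeros , count-zeros , nowhere-zero) , λ S (f , f≢0 , kirchhoff) →
    many-zeros (mask S f) (λ v → trans (sym (sum²-mask S f v)) (kirchhoff v)) S (zero-removed S f f≢0)
    where
    open +-*-Solver
    weights : ∀ k → ℕΣ.sum (bit ∘ zeros k) ≡ _
    weights _ = refl
    count-zeros : count (spread zeros) ≡ suc n
    count-zeros = trans (count-spread zeros _ weights)
      (solve 1 (λ n → con 1 :+ (n :* con 1 :+ (con 0 :+ n :* con 0)) := con 1 :+ n) refl n)
    zero-removed : ∀ S f → (∀ e → S e ≡ false → f e ≢ zero²) → ∀ e → mask S f e ≡ zero² → S e ≡ true
    zero-removed S f f≢0 e eq with S e in Se
    ... | true  = refl
    ... | false = ⊥-elim (f≢0 e Se eq)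

theorem1 : (n : ℕ) → 1 ≤ n →
    Σ Graph λ H → (Graph.nV H ≡ 40 * n + 2) × Snark H × CyclicallyEdgeConnected H 5
    × ResistanceIs H 2 × FlowResistanceIs H n
theorem1 (suc n) _ = Ring.H _ _ _ , nV-H , snark , cyclically-5-connected , resistance , flow-resistance
  where
  open Construction n
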